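{- For every well-typed process $P$ of $\pi$MLL, $P\sim\mathsf{dis}(P)$, where $\sim$ is strong bisimilarity on processes and $\mathsf{dis}(P)$ is the disentanglement of $P$.
   Context: **$\pi$MLL.** Names $x,y,z,\ldots$ come from an infinite set. Types: $A,B::=A\otimes B\mid A\wp B\mid1\mid\bot$ ($\wp$ is "par"), with duality the involution given by $(A\otimes B)^\perp=A^\perp\wp B^\perp$, $(A\wp B)^\perp=A^\perp\otimes B^\perp$, $1^\perp=\bot$, $\bot^\perp=1$. Processes: $P,Q::=x[y].P\mid x(y).P\mid x[].P\mid x().P\mid(\nu xy)P\mid P\parallel Q\mid\mathbf 0$, with $y$ bound in $x[y].P$ and $x(y).P$, and $x,y$ bound in $(\nu xy)P$; $(\nu xy)P$ and $(\nu yx)P$ are identified. Environments $\Gamma$ are finite unordered lists of distinct names with types; hyperenvironments $\mathcal G=\Gamma_1\parallel\cdots\parallel\Gamma_n$ are finite multisets of environments with all names distinct; $\emptyset$ is the hyperenvironment with no environments ("," binds tighter than $\parallel$). Typing rules (premises $\Rightarrow$ conclusion): $\vdash P::\mathcal G\parallel\Gamma,x:A\parallel\Delta,y:A^\perp\Rightarrow\ \vdash(\nu xy)P::\mathcal G\parallel\Gamma,\Delta$; $\vdash P::\mathcal G$ and $\vdash Q::\mathcal H\Rightarrow\ \vdash P\parallel Q::\mathcal G\parallel\mathcal H$; $\vdash\mathbf 0::\emptyset$; $\vdash P::\Gamma,y:A\parallel\Delta,x:B\Rightarrow\ \vdash x[y].P::\Gamma,\Delta,x:A\otimes B$; $\vdash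 P::\emptyset\Rightarrow\ \vdash x[].P::x:1$; $\vdash P::\Gamma,y:A,x:B\Rightarrow\ \vdash x(y).P::\Gamma,x:A\wp B$; $\vdash P::\Gamma\Rightarrow\ \vdash x().P::\Gamma,x:\bot$. $P$ is well-typed if $\vdash P::\mathcal G$ for some $\mathcal G$. **Transitions.** Act consists of $x[],x(),x[y],x(y)$ ($x$ free, $y$ bound); labels are $\tau$, $l$, and unordered pairs $l\parallel l'$ for $l,l'\in$ Act; $\mathrm{cn}(l)=\mathrm{fn}(l)\cup\mathrm{bn}(l)$. The relation is the least closed under: $\pi.P\xrightarrow{\pi}P$ for $\pi\in\{x[],x(),x[y],x(y)\}$; if $P=_\alpha Q\xrightarrow{l}R$ then $P\xrightarrow{l}R$; if $P\xrightarrow{l}P'$ and $\mathrm{bn}(l)\cap\mathrm{fn}(Q)=\emptyset$ then $P\parallel Q\xrightarrow{l}P'\parallel Q$, and symmetrically; if $P\xrightarrow{l}P'$, $Q\xrightarrow{l'}Q'$ with $l,l'\in$ Act and $\mathrm{bn}(l)\cap\mathrm{bn}(l')=\emptyset$ then $P\parallel Q\xrightarrow{l\parallel l'}P'\parallel Q'$; if $P\xrightarrow{l}P'$ and $x,y\notin\mathrm{cn}(l)$ then $(\nu xy)P\xrightarrow{l}(\nu xy)P'$; if $P\xrightarrow{x[]\parallel y()}P'$ then $(\nu xy)P\xrightarrow{\tau}P'$; if $P\xrightarrow{x[x']\parallel y(y')}P'$ then $(\nu xy)P\xrightarrow{\tau}(\nu xy)(\nu x'y')P'$. Strong bisimilarity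 $\sim$ is the largest relation $\mathcal R$ such that $P\mathrel{\mathcal R}Q$ implies: if $P\xrightarrow{l}P'$ then $Q\xrightarrow{l}Q'$ with $P'\mathrel{\mathcal R}Q'$ for some $Q'$, and vice versa. **Disentanglement.** $\mathsf{dis}(P)$ is the process obtained from $P$ by recursively rewriting it with the following laws, read left to right, until no longer possible: $P\parallel\mathbf 0\mapsto P$; $(\nu xy)(P\parallel Q)\mapsto(\nu xy)P\parallel Q$ if $x,y\notin\mathrm{fn}(Q)$; $(\nu xy)(P\parallel Q)\mapsto P\parallel(\nu xy)Q$ if $x,y\notin\mathrm{fn}(P)$. Parallel compositions are read modulo associativity, commutativity and unit $\mathbf 0$. Equivalently: $\mathsf{dis}(\pi.P)=\pi.\mathsf{dis}(P)$; $\mathsf{dis}(\mathbf 0)=\mathbf 0$; $\mathsf{dis}(P\parallel Q)=\mathsf{dis}(P)\parallel\mathsf{dis}(Q)$; and if $\mathsf{dis}(P)=P_1\parallel\cdots\parallel P_n$ with $x\in\mathrm{fn}(P_i)$, $y\in\mathrm{fn}(P_j)$, then $\mathsf{dis}((\nu xy)P)$ is $(\nu xy)(P_i\parallel P_j)$ in parallel with all $P_k$, $k\neq i,j$.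
   Formalization: The rule deriving P∥Q –l∥l′→ P′∥Q′ is given the extra side conditions bn(l)∩fn(Q)=∅ and bn(l′)∩fn(P)=∅; with only bn(l)∩bn(l′)=∅ a synchronisation can capture a free name of the parallel context and the claim fails. -}

module Defs where

open import Data.Bool using (if_then_else_)
open import Data.List using (List; []; _∷_; [_]; _++_; map; concatMap; filter; partition)
open import Data.List.Membership.Propositional using (_∈_; _∉_)
import Data.List.Membership.DecPropositional as DecMembership
open import Data.List.Relation.Binary.Disjoint.Propositional using (Disjoint)
open import Data.List.Relation.Binary.Permutation.Propositional using (_↭_)
open import Data.List.Relation.Binary.Permutation.Homogeneous using (Permutation)
open import Data.List.Relation.Unary.Unique.Propositional using (Unique)
open import Data.Product using (_×_; _,_; proj₁; ∃-syntax; Σ-syntax)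
open import Data.Sum using (_⊎_)
open import Level using (0ℓ)
open import Relation.Binary using (Rel; DecidableEquality)
open import Relation.Binary.PropositionalEquality using (_≡_; _≢_)
open import Relation.Nullary using (Dec; does)
open import Relation.Nullary.Decidable using (¬?; _⊎-dec_)

-- Infinity is expressed by the existence of a name outside any finite list.
record NameSet : Set₁ where
  field
    Name     : Set
    _≟_      : DecidableEquality Name
    infinite : (xs : List Name) → ∃[ x ] x ∉ xs

infixr 7 _⊗_ _⅋_

data Type : Set where
  _⊗_ _⅋_ : Type → Type → Type
  𝟏 ⊥     : Type

infix 8 _ᗮ

_ᗮ : Type → Type
(A ⊗ B) ᗮ = A ᗮ ⅋ B ᗮ
(A ⅋ B) ᗮ = A ᗮ ⊗ B ᗮ
𝟏 ᗮ       = ⊥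
⊥ ᗮ       = 𝟏

module πMLL (𝒩 : NameSet) where
  open NameSet 𝒩
  open DecMembership _≟_ using (_∈?_)

  -- Act serves both as the set of prefixes π of processes π.P and as the
  -- set of elementary labels:
  --   send x y is x[y],  recv x y is x(y),  close x is x[],  wait x is x().
  data Act : Set where
    send recv  : (x y : Name) → Act
    close wait : (x : Name) → Act

  fnAct bnAct : Act → List Name
  fnAct (send x y) = [ x ]
  fnAct (recv x y) = [ x ]
  fnAct (close x)  = [ x ]
  fnAct (wait x)   = [ x ]
  bnAct (send x y) = [ y ]
  bnAct (recv x y) = [ y ]
  bnAct (close x)  = []
  bnAct (wait x)   = []

  infixr 6 _∙_
  infixr 5 _∥_

  data Proc : Set where
    _∙_ : Act → Proc → Proc
    ν   : (x y : Name) → Proc → Proc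
    _∥_ : Proc → Proc → Proc
    𝟎   : Proc

  infixl 5 _∖_

  _∖_ : List Name → List Name → List Name
  xs ∖ ys = filter (λ x → ¬? (x ∈? ys)) xs

  -- The subject x of x[y].P and x(y).P lies outside the scope of y.
  fn : Proc → List Name
  fn (π ∙ P)   = fnAct π ++ (fn P ∖ bnAct π)
  fn (ν x y P) = fn P ∖ (x ∷ y ∷ [])
  fn (P ∥ Q)   = fn P ++ fn Q
  fn 𝟎         = []

  swapName : Name → Name → Name → Name
  swapName a b x =
    if does (x ≟ a) then b else if does (x ≟ b) then a else x

  swapAct : Name → Name → Act → Act
  swapAct a b (send x y) = send (swapName a b x) (swapName a b y)
  swapAct a b (recv x y) = recv (swapName a b x) (swapName a b y)
  swapAct a b (close x)  = close (swapName a b x)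
  swapAct a b (wait x)   = wait (swapName a b x)

  -- Exchanges a and b everywhere, binding occurrences included.
  swap : Name → Name → Proc → Proc
  swap a b (π ∙ P)   = swapAct a b π ∙ swap a b P
  swap a b (ν x y P) = ν (swapName a b x) (swapName a b y) (swap a b P)
  swap a b (P ∥ Q)   = swap a b P ∥ swap a b Q
  swap a b 𝟎         = 𝟎

  infix 4 _=α_

  -- Renaming y to z is done by the swap (y z), which for z ∉ fn P agrees with
  -- capture-avoiding substitution up to α-equivalence.  The identification of
  -- (νxy)P with (νyx)P is included as ν-comm, so that ν-rename, stated for the
  -- first bound name, covers the second as well.
  data _=α_ : Rel Proc 0ℓ where
    α-refl      : ∀ {P} → P =α P
    α-sym       : ∀ {P Q} → P =α Q → Q =α P
    α-trans     : ∀ {P Q R} → P =α Q → Q =α R → P =α R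
    ∙-cong      : ∀ {π P Q} → P =α Q → π ∙ P =α π ∙ Q
    ν-cong      : ∀ {x y P Q} → P =α Q → ν x y P =α ν x y Q
    ∥-cong      : ∀ {P P′ Q Q′} → P =α P′ → Q =α Q′ → P ∥ Q =α P′ ∥ Q′
    send-rename : ∀ {x y z P} → z ∉ fn P →
                  send x y ∙ P =α send x z ∙ swap y z P
    recv-rename : ∀ {x y z P} → z ∉ fn P →
                  recv x y ∙ P =α recv x z ∙ swap y z P
    ν-rename    : ∀ {x y z P} → x ≢ y → z ≢ y → z ∉ fn P →
                  ν x y P =α ν z y (swap x z P)
    ν-comm      : ∀ {x y P} → ν x y P =α ν y x P

  Env : Set
  Env = List (Name × Type)

  HyperEnv : Set
  HyperEnv = List Env

  -- Equality of hyperenvironments as multisets of unordered environments.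
  infix 4 _≋_

  _≋_ : Rel HyperEnv 0ℓ
  _≋_ = Permutation _↭_

  Distinct : HyperEnv → Set
  Distinct 𝒢 = Unique (concatMap (map proj₁) 𝒢)

  infix 3 ⊢_∷∷_

  -- The requirement that all names of a hyperenvironment be distinct is imposed
  -- in mix and bot; in the other rules the conclusion inherits it.
  data ⊢_∷∷_ : Proc → HyperEnv → Set where
    exch : ∀ {P 𝒢 ℋ} → 𝒢 ≋ ℋ → ⊢ P ∷∷ 𝒢 → ⊢ P ∷∷ ℋ
    cut  : ∀ {x y P A Γ Δ 𝒢} →
           ⊢ P ∷∷ ((x , A) ∷ Γ) ∷ ((y , A ᗮ) ∷ Δ) ∷ 𝒢 →
           ⊢ ν x y P ∷∷ (Γ ++ Δ) ∷ 𝒢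
    mix  : ∀ {P Q 𝒢 ℋ} → Distinct (𝒢 ++ ℋ) →
           ⊢ P ∷∷ 𝒢 → ⊢ Q ∷∷ ℋ → ⊢ P ∥ Q ∷∷ 𝒢 ++ ℋ
    mix₀ : ⊢ 𝟎 ∷∷ []
    tens : ∀ {x y P A B Γ Δ} →
           ⊢ P ∷∷ ((y , A) ∷ Γ) ∷ ((x , B) ∷ Δ) ∷ [] →
           ⊢ send x y ∙ P ∷∷ [ (x , A ⊗ B) ∷ Γ ++ Δ ]
    one  : ∀ {x P} → ⊢ P ∷∷ [] → ⊢ close x ∙ P ∷∷ [ [ x , 𝟏 ] ]
    parr : ∀ {x y P A B Γ} →
           ⊢ P ∷∷ [ (y , A) ∷ (x , B) ∷ Γ ] →
           ⊢ recv x y ∙ P ∷∷ [ (x , A ⅋ B) ∷ Γ ]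
    bot  : ∀ {x P Γ} → Distinct [ (x , ⊥) ∷ Γ ] →
           ⊢ P ∷∷ [ Γ ] → ⊢ wait x ∙ P ∷∷ [ (x , ⊥) ∷ Γ ]

  WellTyped : Proc → Set
  WellTyped P = ∃[ 𝒢 ] (⊢ P ∷∷ 𝒢)

  -- pair l l′ is the label l ∥ l′; that such pairs are unordered is expressed
  -- by the rule pair-comm of the transition relation.
  data Label : Set where
    τ    : Label
    act  : Act → Label
    pair : Act → Act → Label

  fnL bnL cn : Label → List Name
  fnL τ           = []
  fnL (act l)     = fnAct l
  fnL (pair l l′) = fnAct l ++ fnAct l′
  bnL τ           = []
  bnL (act l)     = bnAct l
  bnL (pair l l′) = bnAct l ++ bnAct l′
  cn l = fnL l ++ bnL l

  infix 3 _─⟨_⟩→_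

  -- The hypotheses of syn on fn Q and fn P are the convention that names bound in
  -- a label are fresh for the parallel context, as in par₁ and par₂.  With only
  -- Disjoint (bnAct l) (bnAct l′), a free w of Q could be captured by a
  -- synchronisation on x[w] and y(y′): (νxy)(x[x′].P ∥ (y(y′).Q ∥ w[].𝟎)) could
  -- reduce to (νxy)(νwy′)(P{w/x′} ∥ (Q ∥ w[].𝟎)), so ∥ would not be associative
  -- up to bisimilarity and disentangling w[].𝟎 would not be sound.
  data _─⟨_⟩→_ : Proc → Label → Proc → Set where
    prefix    : ∀ {π P} → π ∙ P ─⟨ act π ⟩→ P
    alpha     : ∀ {P Q R l} → P =α Q → Q ─⟨ l ⟩→ R → P ─⟨ l ⟩→ R
    par₁      : ∀ {P P′ Q l} → Disjoint (bnL l) (fn Q) →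
                P ─⟨ l ⟩→ P′ → P ∥ Q ─⟨ l ⟩→ P′ ∥ Q
    par₂      : ∀ {P Q Q′ l} → Disjoint (bnL l) (fn P) →
                Q ─⟨ l ⟩→ Q′ → P ∥ Q ─⟨ l ⟩→ P ∥ Q′
    syn       : ∀ {P P′ Q Q′ l l′} →
                Disjoint (bnAct l) (bnAct l′) →
                Disjoint (bnAct l) (fn Q) → Disjoint (bnAct l′) (fn P) →
                P ─⟨ act l ⟩→ P′ → Q ─⟨ act l′ ⟩→ Q′ →
                P ∥ Q ─⟨ pair l l′ ⟩→ P′ ∥ Q′
    pair-comm : ∀ {P P′ l l′} →
                P ─⟨ pair l l′ ⟩→ P′ → P ─⟨ pair l′ l ⟩→ P′
    res       : ∀ {x y P P′ l} → x ∉ cn l → y ∉ cn l →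
                P ─⟨ l ⟩→ P′ → ν x y P ─⟨ l ⟩→ ν x y P′
    com-unit  : ∀ {x y P P′} →
                P ─⟨ pair (close x) (wait y) ⟩→ P′ → ν x y P ─⟨ τ ⟩→ P′
    com       : ∀ {x y x′ y′ P P′} →
                P ─⟨ pair (send x x′) (recv y y′) ⟩→ P′ →
                ν x y P ─⟨ τ ⟩→ ν x y (ν x′ y′ P′)

  record IsBisimulation (ℛ : Rel Proc 0ℓ) : Set where
    field
      forth : ∀ {P Q} → ℛ P Q → ∀ {l P′} → P ─⟨ l ⟩→ P′ →
              ∃[ Q′ ] (Q ─⟨ l ⟩→ Q′) × ℛ P′ Q′
      back  : ∀ {P Q} → ℛ P Q → ∀ {l Q′} → Q ─⟨ l ⟩→ Q′ →
              ∃[ P′ ] (P ─⟨ l ⟩→ P′) × ℛ P′ Q′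

  infix 4 _∼_

  -- The largest bisimulation, as the union of all bisimulations.
  _∼_ : Proc → Proc → Set₁
  P ∼ Q = Σ[ ℛ ∈ Rel Proc 0ℓ ] IsBisimulation ℛ × ℛ P Q

  ∏ : List Proc → Proc
  ∏ []           = 𝟎
  ∏ (P ∷ [])     = P
  ∏ (P ∷ Q ∷ Ps) = P ∥ ∏ (Q ∷ Ps)

  mentions? : (x y : Name) (P : Proc) → Dec (x ∈ fn P ⊎ y ∈ fn P)
  mentions? x y P = (x ∈? fn P) ⊎-dec (y ∈? fn P)

  -- disComponents P lists the P₁ , … , Pₙ with dis P = P₁ ∥ ⋯ ∥ Pₙ, representing
  -- parallel compositions modulo associativity, commutativity and unit.  In the
  -- case of ν, when P is well-typed, exactly one component has x free and
  -- exactly one has y free, so that inside consists of these Pᵢ and Pⱼ.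
  disComponents : Proc → List Proc
  disComponents (π ∙ P)   = [ π ∙ ∏ (disComponents P) ]
  disComponents 𝟎         = []
  disComponents (P ∥ Q)   = disComponents P ++ disComponents Q
  disComponents (ν x y P) =
    let (inside , outside) = partition (mentions? x y) (disComponents P)
    in ν x y (∏ inside) ∷ outside

  dis : Proc → Proc
  dis P = ∏ (disComponents P)

-- dis only uses the commutative monoid laws of ∥ and scope extrusion, so P and
-- dis P are structurally congruent, and structural congruence is a bisimulation on
-- processes with a linear use of names, a consequence of typability that
-- transitions preserve.  To match a transition under ν x y, the binder is first
-- renamed away from the label.  The inversion of α-equivalence then presents the
-- transition as one of the body, with the same binder.  When a synchronisation
-- below ν x y is moved past ∥, the names bound in its label may occur in the other
-- component; the transition is then repeated with fresh bound names.
module Submission where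

open import Defs
open import Data.List using (List; []; _∷_; [_]; _++_; map; concatMap; partition)
open import Data.List.Properties using (map-++; ++-assoc)
open import Data.List.Membership.Propositional using (_∈_; _∉_)
open import Data.List.Membership.Propositional.Properties
  using (∈-++⁺ˡ; ∈-++⁺ʳ; ∈-++⁻; ∈-map⁺; ∈-map⁻; ∈-filter⁺; ∈-filter⁻)
import Data.List.Membership.DecPropositional as DecMembership
open import Data.List.Relation.Binary.Disjoint.Propositional using (Disjoint)
open import Data.List.Relation.Unary.Any using (here; there)
open import Data.Bool using (true; false)
open import Data.List.Properties using (concatMap-++)
open import Data.List.Relation.Binary.Permutation.Homogeneous as Homogeneous using ()
open import Data.List.Relation.Binary.Permutation.Propositional
  using (_↭_; prep; ↭-refl; ↭-trans; ↭-reflexive; ↭⇒↭ₛ)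
open import Data.List.Relation.Binary.Permutation.Propositional.Properties
  using (∈-resp-↭; map⁺; ++⁺; shift; shifts)
import Data.List.Relation.Binary.Permutation.Setoid.Properties as Permutationₛ
open import Data.List.Relation.Binary.Pointwise using (Pointwise; []; _∷_)
open import Data.List.Relation.Unary.All as All using (All; []; _∷_; lookup)
open import Data.List.Relation.Unary.All.Properties using (partition-All)
open import Data.List.Relation.Unary.AllPairs using ([]; _∷_)
open import Data.List.Relation.Unary.Unique.Propositional using (Unique)
open import Data.Product using (_×_; _,_; proj₁; proj₂; ∃-syntax)
open import Data.Sum using (_⊎_; inj₁; inj₂; [_,_]′)
open import Function using (_∘_; id; _↔_; mk↔ₛ′; Inverse)
open import Function.Properties.Inverse using (↔-refl; ↔-sym; ↔-trans)
open import Level using (0ℓ)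
open import Relation.Binary using (Rel)
open import Relation.Binary.PropositionalEquality
  using (_≡_; _≢_; refl; sym; trans; cong; cong₂; subst; subst₂; setoid)
open import Relation.Nullary using (¬_; does; yes; no; contradiction)
open import Relation.Nullary.Decidable using (¬?)

-- Renamings are bijections of names that act on binders as well as on free occurrences. They never
-- capture a name, they commute with every rule, and they compose and invert; the `swap` of the
-- definitions is the case of a transposition. Two obstacles come from `=α`. It is generated with
-- symmetry and transitivity, and `alpha` may occur anywhere in a derivation, so a case split on a
-- transition says little about its source; `Head` is a syntax-directed relation containing `=α`
-- that restores inversion. Moreover `ν-rename` asks for distinct binders, so those of `ν x x P` can
-- never be changed, and the expected principle that only the values of a renaming on free names
-- matter fails for it. The invariant `Linear` excludes such processes, and it is this invariant,
-- not a typing derivation, that is carried along transitions.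

module Disentanglement (𝒩 : NameSet) where
  open NameSet 𝒩
  open πMLL 𝒩
  open DecMembership _≟_ using (_∈?_)

  private variable
    x y z w n m : Name
    xs ys L : List Name
    P P′ Q Q′ R S T : Proc
    π π′ : Act
    l l′ : Label

  -- Renaming by bijections of names

  Perm : Set
  Perm = Name ↔ Name

  infixr 9 _·_ _⊙_
  infix 10 _⁻¹

  _·_ : Perm → Name → Name
  _·_ = Inverse.to

  _⁻¹ : Perm → Perm
  _⁻¹ = ↔-sym

  _⊙_ : Perm → Perm → Perm
  g ⊙ f = ↔-trans f g

  ⁻¹-· : ∀ f {x} → f ⁻¹ · f · x ≡ x
  ⁻¹-· f = Inverse.strictlyInverseʳ f _

  ·-⁻¹ : ∀ f {x} → f · f ⁻¹ · x ≡ x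
  ·-⁻¹ f = Inverse.strictlyInverseˡ f _

  ·-injective : ∀ f → f · x ≡ f · y → x ≡ y
  ·-injective f eq = trans (sym (⁻¹-· f)) (trans (cong (f ⁻¹ ·_) eq) (⁻¹-· f))

  swapName-left : ∀ a b → swapName a b a ≡ b
  swapName-left a b with a ≟ a
  ... | yes _  = refl
  ... | no a≢a = contradiction refl a≢a

  swapName-right : ∀ a b → swapName a b b ≡ a
  swapName-right a b with b ≟ a
  ... | yes b≡a = b≡a
  ... | no _ with b ≟ b
  ...   | yes _  = refl
  ...   | no b≢b = contradiction refl b≢b

  swapName-other : ∀ {a b} → x ≢ a → x ≢ b → swapName a b x ≡ x
  swapName-other {x} {a} {b} x≢a x≢b with x ≟ a
  ... | yes x≡a = contradiction x≡a x≢a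
  ... | no _ with x ≟ b
  ...   | yes x≡b = contradiction x≡b x≢b
  ...   | no _    = refl

  swapName-involutive : ∀ a b x → swapName a b (swapName a b x) ≡ x
  swapName-involutive a b x with x ≟ a
  ... | yes refl = swapName-right x b
  ... | no x≢a with x ≟ b
  ...   | yes refl = swapName-left a x
  ...   | no x≢b   = swapName-other x≢a x≢b

  transp : Name → Name → Perm
  transp a b = mk↔ₛ′ (swapName a b) (swapName a b)
                 (swapName-involutive a b) (swapName-involutive a b)

  -- Conjugating a transposition by `f` gives the transposition of the images; this makes the
  -- renaming rules of `=α` equivariant.
  ·-swapName : ∀ f a b x → f · swapName a b x ≡ swapName (f · a) (f · b) (f · x)
  ·-swapName f a b x with x ≟ a
  ... | yes refl = sym (swapName-left (f · x) (f · b))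
  ... | no x≢a with x ≟ b
  ...   | yes refl = sym (swapName-right (f · a) (f · x))
  ...   | no x≢b   =
    sym (swapName-other (x≢a ∘ ·-injective f) (x≢b ∘ ·-injective f))

  renAct : Perm → Act → Act
  renAct f (send x y) = send (f · x) (f · y)
  renAct f (recv x y) = recv (f · x) (f · y)
  renAct f (close x)  = close (f · x)
  renAct f (wait x)   = wait (f · x)

  ren : Perm → Proc → Proc
  ren f (π ∙ P)   = renAct f π ∙ ren f P
  ren f (ν x y P) = ν (f · x) (f · y) (ren f P)
  ren f (P ∥ Q)   = ren f P ∥ ren f Q
  ren f 𝟎         = 𝟎

  renLabel : Perm → Label → Label
  renLabel f τ           = τ
  renLabel f (act l)     = act (renAct f l)
  renLabel f (pair l l′) = pair (renAct f l) (renAct f l′)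

  -- In contrast with renAct, the subject is kept, even if it equals the bound name.
  rebindAct : Perm → Act → Act
  rebindAct f (send x y) = send x (f · y)
  rebindAct f (recv x y) = recv x (f · y)
  rebindAct f (close x)  = close x
  rebindAct f (wait x)   = wait x

  rebind : Perm → Label → Label
  rebind f τ           = τ
  rebind f (act l)     = act (rebindAct f l)
  rebind f (pair l l′) = pair (rebindAct f l) (rebindAct f l′)

  swapAct≡renAct : ∀ a b π → swapAct a b π ≡ renAct (transp a b) π
  swapAct≡renAct a b (send x y) = refl
  swapAct≡renAct a b (recv x y) = refl
  swapAct≡renAct a b (close x)  = refl
  swapAct≡renAct a b (wait x)   = refl

  swap≡ren : ∀ a b P → swap a b P ≡ ren (transp a b) P
  swap≡ren a b (π ∙ P)   = cong₂ _∙_ (swapAct≡renAct a b π) (swap≡ren a b P)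
  swap≡ren a b (ν x y P) = cong (ν _ _) (swap≡ren a b P)
  swap≡ren a b (P ∥ Q)   = cong₂ _∥_ (swap≡ren a b P) (swap≡ren a b Q)
  swap≡ren a b 𝟎         = refl

  renAct-ext : ∀ {f g} → (∀ n → f · n ≡ g · n) → ∀ π → renAct f π ≡ renAct g π
  renAct-ext e (send x y) = cong₂ send (e x) (e y)
  renAct-ext e (recv x y) = cong₂ recv (e x) (e y)
  renAct-ext e (close x)  = cong close (e x)
  renAct-ext e (wait x)   = cong wait (e x)

  ren-ext : ∀ {f g} → (∀ n → f · n ≡ g · n) → ∀ P → ren f P ≡ ren g P
  ren-ext e (π ∙ P) = cong₂ _∙_ (renAct-ext e π) (ren-ext e P)
  ren-ext {f} {g} e (ν x y P) rewrite e x | e y = cong (ν _ _) (ren-ext e P)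
  ren-ext e (P ∥ Q) = cong₂ _∥_ (ren-ext e P) (ren-ext e Q)
  ren-ext e 𝟎       = refl

  renAct-⊙ : ∀ g f π → renAct g (renAct f π) ≡ renAct (g ⊙ f) π
  renAct-⊙ g f (send x y) = refl
  renAct-⊙ g f (recv x y) = refl
  renAct-⊙ g f (close x)  = refl
  renAct-⊙ g f (wait x)   = refl

  ren-⊙ : ∀ g f P → ren g (ren f P) ≡ ren (g ⊙ f) P
  ren-⊙ g f (π ∙ P)   = cong₂ _∙_ (renAct-⊙ g f π) (ren-⊙ g f P)
  ren-⊙ g f (ν x y P) = cong (ν _ _) (ren-⊙ g f P)
  ren-⊙ g f (P ∥ Q)   = cong₂ _∥_ (ren-⊙ g f P) (ren-⊙ g f Q)
  ren-⊙ g f 𝟎         = refl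

  renAct-fix : ∀ f π → (∀ {n} → n ∈ fnAct π ++ bnAct π → f · n ≡ n) → renAct f π ≡ π
  renAct-fix f (send x y) e = cong₂ send (e (here refl)) (e (there (here refl)))
  renAct-fix f (recv x y) e = cong₂ recv (e (here refl)) (e (there (here refl)))
  renAct-fix f (close x)  e = cong close (e (here refl))
  renAct-fix f (wait x)   e = cong wait (e (here refl))

  ren-id : ∀ f → (∀ n → f · n ≡ n) → ∀ P → ren f P ≡ P
  ren-id f e (π ∙ P) = cong₂ _∙_ (renAct-fix f π (λ _ → e _)) (ren-id f e P)
  ren-id f e (ν x y P) rewrite e x | e y = cong (ν _ _) (ren-id f e P)
  ren-id f e (P ∥ Q) = cong₂ _∥_ (ren-id f e P) (ren-id f e Q)
  ren-id f e 𝟎       = refl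

  ren-⁻¹ : ∀ f P → ren (f ⁻¹) (ren f P) ≡ P
  ren-⁻¹ f P = trans (ren-⊙ (f ⁻¹) f P) (ren-id (f ⁻¹ ⊙ f) (λ _ → ⁻¹-· f) P)

  ren-⁻¹ʳ : ∀ f P → ren f (ren (f ⁻¹) P) ≡ P
  ren-⁻¹ʳ f P = trans (ren-⊙ f (f ⁻¹) P) (ren-id (f ⊙ f ⁻¹) (λ _ → ·-⁻¹ f) P)

  ren-swap : ∀ f a b P → ren f (swap a b P) ≡ swap (f · a) (f · b) (ren f P)
  ren-swap f a b P
    rewrite swap≡ren a b P | swap≡ren (f · a) (f · b) (ren f P)
          | ren-⊙ f (transp a b) P | ren-⊙ (transp (f · a) (f · b)) f P
    = ren-ext (·-swapName f a b) P

  cn-pair : ∀ π π′ → n ∈ cn (pair π π′) →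
            n ∈ fnAct π ++ bnAct π ⊎ n ∈ fnAct π′ ++ bnAct π′
  cn-pair π π′ n∈ with ∈-++⁻ (fnAct π ++ fnAct π′) n∈
  ... | inj₁ i with ∈-++⁻ (fnAct π) i
  ...   | inj₁ j = inj₁ (∈-++⁺ˡ j)
  ...   | inj₂ j = inj₂ (∈-++⁺ˡ j)
  cn-pair π π′ n∈ | inj₂ i with ∈-++⁻ (bnAct π) i
  ...   | inj₁ j = inj₁ (∈-++⁺ʳ (fnAct π) j)
  ...   | inj₂ j = inj₂ (∈-++⁺ʳ (fnAct π′) j)

  pair-cnˡ : ∀ π π′ → n ∈ fnAct π ++ bnAct π → n ∈ cn (pair π π′)
  pair-cnˡ π π′ n∈ with ∈-++⁻ (fnAct π) n∈
  ... | inj₁ i = ∈-++⁺ˡ (∈-++⁺ˡ i)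
  ... | inj₂ i = ∈-++⁺ʳ (fnAct π ++ fnAct π′) (∈-++⁺ˡ i)

  pair-cnʳ : ∀ π π′ → n ∈ fnAct π′ ++ bnAct π′ → n ∈ cn (pair π π′)
  pair-cnʳ π π′ n∈ with ∈-++⁻ (fnAct π′) n∈
  ... | inj₁ i = ∈-++⁺ˡ (∈-++⁺ʳ (fnAct π) i)
  ... | inj₂ i = ∈-++⁺ʳ (fnAct π ++ fnAct π′) (∈-++⁺ʳ (bnAct π) i)

  renLabel-fix : ∀ f l → (∀ {n} → n ∈ cn l → f · n ≡ n) → renLabel f l ≡ l
  renLabel-fix f τ           e = refl
  renLabel-fix f (act π)     e = cong act (renAct-fix f π e)
  renLabel-fix f (pair π π′) e =
    cong₂ pair (renAct-fix f π (e ∘ pair-cnˡ π π′)) (renAct-fix f π′ (e ∘ pair-cnʳ π π′))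

  renLabel-⁻¹ʳ : ∀ f l → renLabel f (renLabel (f ⁻¹) l) ≡ l
  renLabel-⁻¹ʳ f τ       = refl
  renLabel-⁻¹ʳ f (act π) =
    cong act (trans (renAct-⊙ f (f ⁻¹) π) (renAct-fix (f ⊙ f ⁻¹) π (λ _ → ·-⁻¹ f)))
  renLabel-⁻¹ʳ f (pair π π′) =
    cong₂ pair (trans (renAct-⊙ f (f ⁻¹) π) (renAct-fix (f ⊙ f ⁻¹) π (λ _ → ·-⁻¹ f)))
               (trans (renAct-⊙ f (f ⁻¹) π′) (renAct-fix (f ⊙ f ⁻¹) π′ (λ _ → ·-⁻¹ f)))

  -- Free names

  ∈-∖⁺ : n ∈ xs → n ∉ ys → n ∈ xs ∖ ys
  ∈-∖⁺ {ys = ys} = ∈-filter⁺ (λ x → ¬? (x ∈? ys))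

  ∈-∖⁻ : n ∈ xs ∖ ys → n ∈ xs × n ∉ ys
  ∈-∖⁻ {xs = xs} {ys} = ∈-filter⁻ (λ x → ¬? (x ∈? ys)) {xs = xs}

  _fixes_ : Perm → List Name → Set
  f fixes xs = ∀ {n} → n ∈ xs → f · n ≡ n

  fnAct-renAct : ∀ f π → fnAct (renAct f π) ≡ map (f ·_) (fnAct π)
  fnAct-renAct f (send x y) = refl
  fnAct-renAct f (recv x y) = refl
  fnAct-renAct f (close x)  = refl
  fnAct-renAct f (wait x)   = refl

  bnAct-renAct : ∀ f π → bnAct (renAct f π) ≡ map (f ·_) (bnAct π)
  bnAct-renAct f (send x y) = refl
  bnAct-renAct f (recv x y) = refl
  bnAct-renAct f (close x)  = refl
  bnAct-renAct f (wait x)   = refl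

  ∈-map-· : ∀ f → f · n ∈ map (f ·_) xs → n ∈ xs
  ∈-map-· f i with m , m∈ , eq ← ∈-map⁻ (f ·_) i =
    subst (_∈ _) (sym (·-injective f eq)) m∈

  fn-ren⁺ : ∀ f P → n ∈ fn P → f · n ∈ fn (ren f P)
  fn-ren⁺ f (π ∙ P) i with ∈-++⁻ (fnAct π) i
  ... | inj₁ j = ∈-++⁺ˡ (subst (_ ∈_) (sym (fnAct-renAct f π)) (∈-map⁺ (f ·_) j))
  ... | inj₂ j with k , n∉ ← ∈-∖⁻ {xs = fn P} j =
    ∈-++⁺ʳ (fnAct (renAct f π))
      (∈-∖⁺ (fn-ren⁺ f P k) (n∉ ∘ ∈-map-· f ∘ subst (_ ∈_) (bnAct-renAct f π)))
  fn-ren⁺ f (ν x y P) i with j , n∉ ← ∈-∖⁻ {xs = fn P} i =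
    ∈-∖⁺ (fn-ren⁺ f P j) (n∉ ∘ ∈-map-· f)
  fn-ren⁺ f (P ∥ Q) i with ∈-++⁻ (fn P) i
  ... | inj₁ j = ∈-++⁺ˡ (fn-ren⁺ f P j)
  ... | inj₂ j = ∈-++⁺ʳ (fn (ren f P)) (fn-ren⁺ f Q j)

  fn-ren⁻ : ∀ f P → n ∈ fn (ren f P) → f ⁻¹ · n ∈ fn P
  fn-ren⁻ f P i = subst (λ Q → _ ∈ fn Q) (ren-⁻¹ f P) (fn-ren⁺ (f ⁻¹) (ren f P) i)

  fn-ren-· : ∀ f P → f · n ∈ fn (ren f P) → n ∈ fn P
  fn-ren-· f P i = subst (_∈ fn P) (⁻¹-· f) (fn-ren⁻ f P i)

  -- The free names of `P` minus `ys` are those of an abstraction of `ys` over `P`. A renaming of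
  -- the body that fixes them changes only the choice of binders. With its converse below, this
  -- covers all three renaming rules of `=α` and the transfer of fixed names in `Head`.
  fn-abs-ren⁺ : ∀ f P → f fixes (fn P ∖ ys) →
                n ∈ fn P ∖ ys → n ∈ fn (ren f P) ∖ map (f ·_) ys
  fn-abs-ren⁺ {ys} f P fix i with j , n∉ ← ∈-∖⁻ {xs = fn P} i =
    subst (_∈ fn (ren f P) ∖ map (f ·_) ys) (fix i) (∈-∖⁺ (fn-ren⁺ f P j) (n∉ ∘ ∈-map-· f))

  fn-abs-ren⁻ : ∀ f P → f fixes (fn P ∖ ys) →
                n ∈ fn (ren f P) ∖ map (f ·_) ys → n ∈ fn P ∖ ys
  fn-abs-ren⁻ {ys} {n} f P fix i with j , n∉ ← ∈-∖⁻ {xs = fn (ren f P)} i =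
    subst (_∈ fn P ∖ ys) (trans (sym (fix k)) (·-⁻¹ f)) k
    where
    k : f ⁻¹ · n ∈ fn P ∖ ys
    k = ∈-∖⁺ (fn-ren⁻ f P j) (λ i → n∉ (subst (_∈ _) (·-⁻¹ f) (∈-map⁺ (f ·_) i)))

  transp-fixes : z ∉ fn P → ∀ ys → transp y z fixes (fn P ∖ (y ∷ ys))
  transp-fixes {P = P} z∉ ys i with j , n∉ ← ∈-∖⁻ {xs = fn P} i =
    swapName-other (n∉ ∘ here) (λ { refl → z∉ j })

  α-reflexive : P ≡ Q → P =α Q
  α-reflexive refl = α-refl

  fn-∙ : ∀ π π′ P Q → fnAct π ≡ fnAct π′ → (n ∈ fn P ∖ bnAct π → n ∈ fn Q ∖ bnAct π′) →
         n ∈ fn (π ∙ P) → n ∈ fn (π′ ∙ Q)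
  fn-∙ π π′ P Q eq h i with ∈-++⁻ (fnAct π) i
  ... | inj₁ j = ∈-++⁺ˡ (subst (_ ∈_) eq j)
  ... | inj₂ j = ∈-++⁺ʳ (fnAct π′) (h j)

  fn-∖ : (n ∈ fn P → n ∈ fn Q) → n ∈ fn P ∖ ys → n ∈ fn Q ∖ ys
  fn-∖ {P = P} h i with j , n∉ ← ∈-∖⁻ {xs = fn P} i = ∈-∖⁺ (h j) n∉

  fn-∥ : (n ∈ fn P → n ∈ fn P′) → (n ∈ fn Q → n ∈ fn Q′) →
         n ∈ fn (P ∥ Q) → n ∈ fn (P′ ∥ Q′)
  fn-∥ {P = P} {P′} h k i with ∈-++⁻ (fn P) i
  ... | inj₁ j = ∈-++⁺ˡ (h j)
  ... | inj₂ j = ∈-++⁺ʳ (fn P′) (k j)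

  fn-swap : z ∉ fn P → (n ∈ fn P ∖ [ y ] → n ∈ fn (swap y z P) ∖ [ z ]) ×
                       (n ∈ fn (swap y z P) ∖ [ z ] → n ∈ fn P ∖ [ y ])
  fn-swap {z} {P} {n} {y} z∉
    rewrite swap≡ren y z P
    with p ← fn-abs-ren⁺ {ys = [ y ]} {n} (transp y z) P (transp-fixes {P = P} z∉ [])
       | q ← fn-abs-ren⁻ {ys = [ y ]} {n} (transp y z) P (transp-fixes {P = P} z∉ [])
    rewrite swapName-left y z
    = p , q

  fn-swap-ν : x ≢ y → z ≢ y → z ∉ fn P →
              (n ∈ fn (ν x y P) → n ∈ fn (ν z y (swap x z P))) ×
              (n ∈ fn (ν z y (swap x z P)) → n ∈ fn (ν x y P))
  fn-swap-ν {x} {y} {z} {P} {n} x≢y z≢y z∉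
    rewrite swap≡ren x z P
    with p ← fn-abs-ren⁺ {ys = x ∷ y ∷ []} {n} (transp x z) P (transp-fixes {P = P} z∉ (y ∷ []))
       | q ← fn-abs-ren⁻ {ys = x ∷ y ∷ []} {n} (transp x z) P (transp-fixes {P = P} z∉ (y ∷ []))
    rewrite swapName-left x z | swapName-other (x≢y ∘ sym) (z≢y ∘ sym)
    = p , q

  ∉-comm : n ∉ x ∷ y ∷ [] → n ∉ y ∷ x ∷ []
  ∉-comm n∉ (here refl)         = n∉ (there (here refl))
  ∉-comm n∉ (there (here refl)) = n∉ (here refl)

  fn-ν-comm : n ∈ fn (ν x y P) → n ∈ fn (ν y x P)
  fn-ν-comm {P = P} i with j , n∉ ← ∈-∖⁻ {xs = fn P} i = ∈-∖⁺ j (∉-comm n∉)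

  fn-α : P =α Q → (n ∈ fn P → n ∈ fn Q) × (n ∈ fn Q → n ∈ fn P)
  fn-α α-refl = id , id
  fn-α (α-sym p) with h , k ← fn-α p = k , h
  fn-α (α-trans p q) with h , k ← fn-α p | h′ , k′ ← fn-α q = h′ ∘ h , k ∘ k′
  fn-α (∙-cong {π} {P} {Q} p) with h , k ← fn-α p =
    fn-∙ π π P Q refl (fn-∖ {P = P} {Q} h) ,
    fn-∙ π π Q P refl (fn-∖ {P = Q} {P} k)
  fn-α (ν-cong {P = P} {Q} p) with h , k ← fn-α p =
    fn-∖ {P = P} {Q} h , fn-∖ {P = Q} {P} k
  fn-α (∥-cong {P} {P′} {Q} {Q′} p q) with h , k ← fn-α p | h′ , k′ ← fn-α q =
    fn-∥ {P = P} {P′} {Q} {Q′} h h′ , fn-∥ {P = P′} {P} {Q′} {Q} k k′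
  fn-α (send-rename {x} {y} {z} {P} z∉) with h , k ← fn-swap {P = P} z∉ =
    fn-∙ (send x y) (send x z) P (swap y z P) refl h ,
    fn-∙ (send x z) (send x y) (swap y z P) P refl k
  fn-α (recv-rename {x} {y} {z} {P} z∉) with h , k ← fn-swap {P = P} z∉ =
    fn-∙ (recv x y) (recv x z) P (swap y z P) refl h ,
    fn-∙ (recv x z) (recv x y) (swap y z P) P refl k
  fn-α (ν-rename {P = P} x≢y z≢y z∉) = fn-swap-ν {P = P} x≢y z≢y z∉
  fn-α (ν-comm {P = P}) = fn-ν-comm {P = P} , fn-ν-comm {P = P}

  -- Equivariance

  ∉-ren : ∀ f P → n ∉ fn P → f · n ∉ fn (ren f P)
  ∉-ren f P n∉ = n∉ ∘ fn-ren-· f P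

  ren-α : ∀ f → P =α Q → ren f P =α ren f Q
  ren-α f α-refl        = α-refl
  ren-α f (α-sym p)     = α-sym (ren-α f p)
  ren-α f (α-trans p q) = α-trans (ren-α f p) (ren-α f q)
  ren-α f (∙-cong p)    = ∙-cong (ren-α f p)
  ren-α f (ν-cong p)    = ν-cong (ren-α f p)
  ren-α f (∥-cong p q)  = ∥-cong (ren-α f p) (ren-α f q)
  ren-α f (send-rename {y = y} {z} {P} z∉) rewrite ren-swap f y z P =
    send-rename (∉-ren f P z∉)
  ren-α f (recv-rename {y = y} {z} {P} z∉) rewrite ren-swap f y z P =
    recv-rename (∉-ren f P z∉)
  ren-α f (ν-rename {x} {y} {z} {P} x≢y z≢y z∉) rewrite ren-swap f x z P =
    ν-rename (x≢y ∘ ·-injective f) (z≢y ∘ ·-injective f) (∉-ren f P z∉)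
  ren-α f ν-comm        = ν-comm

  -- Linearity

  closedAct : Act → List Name
  closedAct (send x y) = []
  closedAct (recv x y) = []
  closedAct (close x)  = [ x ]
  closedAct (wait x)   = [ x ]

  -- The part of typability that the laws of disentanglement depend on: with
  -- ν x x, or with a session used again after being closed, scope extrusion is
  -- not sound.
  data Linear : Proc → Set where
    lin-∙ : Disjoint (closedAct π) (fn P) → Linear P → Linear (π ∙ P)
    lin-ν : x ≢ y → Linear P → Linear (ν x y P)
    lin-∥ : Disjoint (fn P) (fn Q) → Linear P → Linear Q → Linear (P ∥ Q)
    lin-𝟎 : Linear 𝟎

  closedAct-renAct : ∀ f π → closedAct (renAct f π) ≡ map (f ·_) (closedAct π)
  closedAct-renAct f (send x y) = refl
  closedAct-renAct f (recv x y) = refl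
  closedAct-renAct f (close x)  = refl
  closedAct-renAct f (wait x)   = refl

  Disjoint-map : ∀ f → Disjoint xs ys → Disjoint (map (f ·_) xs) (map (f ·_) ys)
  Disjoint-map {xs} {ys} f d (i , j) with m , m∈ , refl ← ∈-map⁻ (f ·_) i =
    d (m∈ , ∈-map-· f j)

  Disjoint-fn-ren : ∀ f → Disjoint xs (fn P) → Disjoint (map (f ·_) xs) (fn (ren f P))
  Disjoint-fn-ren {P = P} f d (i , j) with m , m∈ , refl ← ∈-map⁻ (f ·_) i =
    d (m∈ , fn-ren-· f P j)

  ren-linear : ∀ f → Linear P → Linear (ren f P)
  ren-linear f (lin-∙ {π} {P} d p) =
    lin-∙ (subst (λ xs → Disjoint xs (fn (ren f P))) (sym (closedAct-renAct f π))
            (Disjoint-fn-ren {P = P} f d))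
          (ren-linear f p)
  ren-linear f (lin-ν x≢y p) = lin-ν (x≢y ∘ ·-injective f) (ren-linear f p)
  ren-linear f (lin-∥ {P} {Q} d p q) =
    lin-∥ (λ (i , j) → d (fn-ren⁻ f P i , fn-ren⁻ f Q j)) (ren-linear f p) (ren-linear f q)
  ren-linear f lin-𝟎 = lin-𝟎

  swap-linear : ∀ a b → Linear P → Linear (swap a b P)
  swap-linear {P} a b p = subst Linear (sym (swap≡ren a b P)) (ren-linear (transp a b) p)

  swap-linear⁻ : ∀ a b → Linear (swap a b P) → Linear P
  swap-linear⁻ {P} a b p rewrite swap≡ren a b P =
    subst Linear (ren-⁻¹ (transp a b) P) (ren-linear (transp a b ⁻¹) p)

  linear-α : P =α Q → (Linear P → Linear Q) × (Linear Q → Linear P)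
  linear-α α-refl = id , id
  linear-α (α-sym p) with h , k ← linear-α p = k , h
  linear-α (α-trans p q) with h , k ← linear-α p | h′ , k′ ← linear-α q = h′ ∘ h , k ∘ k′
  linear-α (∙-cong p) with h , k ← linear-α p =
    (λ { (lin-∙ d l) → lin-∙ (λ (i , j) → d (i , proj₂ (fn-α p) j)) (h l) }) ,
    (λ { (lin-∙ d l) → lin-∙ (λ (i , j) → d (i , proj₁ (fn-α p) j)) (k l) })
  linear-α (ν-cong p) with h , k ← linear-α p =
    (λ { (lin-ν x≢y l) → lin-ν x≢y (h l) }) , (λ { (lin-ν x≢y l) → lin-ν x≢y (k l) })
  linear-α (∥-cong p q) with h , k ← linear-α p | h′ , k′ ← linear-α q =
    (λ { (lin-∥ d l m) →
       lin-∥ (λ (i , j) → d (proj₂ (fn-α p) i , proj₂ (fn-α q) j)) (h l) (h′ m) }) ,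
    (λ { (lin-∥ d l m) →
       lin-∥ (λ (i , j) → d (proj₁ (fn-α p) i , proj₁ (fn-α q) j)) (k l) (k′ m) })
  linear-α (send-rename {y = y} {z} z∉) =
    (λ { (lin-∙ _ l) → lin-∙ (λ ()) (swap-linear y z l) }) ,
    (λ { (lin-∙ _ l) → lin-∙ (λ ()) (swap-linear⁻ y z l) })
  linear-α (recv-rename {y = y} {z} z∉) =
    (λ { (lin-∙ _ l) → lin-∙ (λ ()) (swap-linear y z l) }) ,
    (λ { (lin-∙ _ l) → lin-∙ (λ ()) (swap-linear⁻ y z l) })
  linear-α (ν-rename {x} {y} {z} x≢y z≢y z∉) =
    (λ { (lin-ν _ l) → lin-ν z≢y (swap-linear x z l) }) ,
    (λ { (lin-ν _ l) → lin-ν x≢y (swap-linear⁻ x z l) })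
  linear-α ν-comm =
    (λ { (lin-ν x≢y l) → lin-ν (x≢y ∘ sym) l }) , (λ { (lin-ν x≢y l) → lin-ν (x≢y ∘ sym) l })

  -- Renamings that agree on the free names

  AgreeOn : List Name → Perm → Perm → Set
  AgreeOn xs f g = ∀ {n} → n ∈ xs → f · n ≡ g · n

  -- The transpositions send both `f · y` and `g · y` to `z`, so agreement is gained at `y`;
  -- elsewhere nothing changes, because `z` is the image of no name of `xs`.
  agree-transp : ∀ {f g} ys → AgreeOn (xs ∖ (y ∷ ys)) f g →
                 z ∉ map (f ·_) xs → z ∉ map (g ·_) xs →
                 AgreeOn (xs ∖ ys) (transp (f · y) z ⊙ f) (transp (g · y) z ⊙ g)
  agree-transp {xs} {y} {z} {f} {g} ys a zf zg {n} i
    with n ≟ y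
  ... | yes refl = trans (swapName-left (f · n) z) (sym (swapName-left (g · n) z))
  ... | no n≢y with j , n∉ ← ∈-∖⁻ {xs = xs} i =
    trans (swapName-other (n≢y ∘ ·-injective f) (λ { refl → zf (∈-map⁺ (f ·_) j) }))
      (trans (a (∈-∖⁺ j λ { (here n≡y) → n≢y n≡y ; (there k) → n∉ k }))
        (sym (swapName-other (n≢y ∘ ·-injective g) (λ { refl → zg (∈-map⁺ (g ·_) j) }))))

  ∉-map⇒∉-ren : ∀ f P → z ∉ map (f ·_) (fn P) → z ∉ fn (ren f P)
  ∉-map⇒∉-ren f P z∉ i =
    z∉ (subst (_∈ map (f ·_) (fn P)) (·-⁻¹ f) (∈-map⁺ (f ·_) (fn-ren⁻ f P i)))

  swap-ren : ∀ f a b P → swap a b (ren f P) ≡ ren (transp a b ⊙ f) P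
  swap-ren f a b P = trans (swap≡ren a b (ren f P)) (ren-⊙ (transp a b) f P)

  ∉-++⁻ˡ : n ∉ xs ++ ys → n ∉ xs
  ∉-++⁻ˡ n∉ = n∉ ∘ ∈-++⁺ˡ

  ∉-++⁻ʳ : ∀ xs → n ∉ xs ++ ys → n ∉ ys
  ∉-++⁻ʳ xs n∉ = n∉ ∘ ∈-++⁺ʳ xs

  -- The second binder is reached by `ν-rename` between two uses of `ν-comm`. By `x ≢ y` and
  -- `z ≢ f · y`, the first renaming leaves the image of `y` in place.
  ν-rename₂ : ∀ f → let f′ = transp (f · x) z ⊙ f in
              x ≢ y → z ≢ f · y → z ∉ map (f ·_) (fn P) → w ≢ z → w ∉ map (f′ ·_) (fn P) →
              ren f (ν x y P) =α ν z w (swap (f′ · y) w (ren f′ P))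
  ν-rename₂ {x} {z} {y} {P} {w} f x≢y z≢fy z∉ w≢z w∉ =
    α-trans (ν-rename (x≢y ∘ ·-injective f) z≢fy (∉-map⇒∉-ren f P z∉))
    (α-trans (α-reflexive (cong₂ (ν z) (sym f′y≡fy) (swap-ren f (f · x) z P)))
    (α-trans ν-comm
    (α-trans (ν-rename (z≢fy ∘ sym ∘ trans (sym f′y≡fy)) w≢z (∉-map⇒∉-ren f′ P w∉)) ν-comm)))
    where
    f′ = transp (f · x) z ⊙ f
    f′y≡fy : f′ · y ≡ f · y
    f′y≡fy = swapName-other (x≢y ∘ sym ∘ ·-injective f) (z≢fy ∘ sym)

  mutual
    -- Both sides are given the same fresh binders, after which the two renamings of the body agree
    -- on the binders too. The induction therefore has to range over arbitrary pairs `f`, `g`.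
    -- Linearity supplies the distinct binders that `ν-rename` asks for.
    ren-agree : ∀ f g → Linear P → AgreeOn (fn P) f g → ren f P =α ren g P
    ren-agree f g (lin-∙ {send x y} _ p) a rewrite a (here refl) =
      rebind-agree {π = send (g · x) y} f g p (a ∘ there)
    ren-agree f g (lin-∙ {recv x y} _ p) a rewrite a (here refl) =
      rebind-agree {π = recv (g · x) y} f g p (a ∘ there)
    ren-agree f g (lin-∙ {close x} _ p) a rewrite a (here refl) =
      rebind-agree {π = close (g · x)} f g p (a ∘ there)
    ren-agree f g (lin-∙ {wait x} _ p) a rewrite a (here refl) =
      rebind-agree {π = wait (g · x)} f g p (a ∘ there)
    ren-agree f g (lin-ν {x} {y} {P} x≢y p) a
      with z , z∉ ← infinite (f · y ∷ g · y ∷ map (f ·_) (fn P) ++ map (g ·_) (fn P))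
      -- `w` is chosen after `z`, since it has to avoid images under `f′` and `g′`, which depend on
      -- `z`.
      with w , w∉ ← infinite (z ∷ map ((transp (f · x) z ⊙ f) ·_) (fn P) ++
                                  map ((transp (g · x) z ⊙ g) ·_) (fn P)) =
      α-trans (ν-rename₂ f x≢y (z∉ ∘ here) zf (w∉ ∘ here) (∉-++⁻ˡ (w∉ ∘ there)))
      (α-trans (ν-cong (swap-agree f′ g′ p (agree-transp {f = f} {g} [ y ] a zf zg) (w∉ ∘ there)))
      (α-sym (ν-rename₂ g x≢y (z∉ ∘ there ∘ here) zg (w∉ ∘ here)
               (∉-++⁻ʳ (map (f′ ·_) (fn P)) (w∉ ∘ there)))))
      where
      f′ = transp (f · x) z ⊙ f
      g′ = transp (g · x) z ⊙ g
      zf = ∉-++⁻ˡ (z∉ ∘ there ∘ there)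
      zg = ∉-++⁻ʳ (map (f ·_) (fn P)) (z∉ ∘ there ∘ there)
    ren-agree f g (lin-∥ {P} _ p q) a =
      ∥-cong (ren-agree f g p (a ∘ ∈-++⁺ˡ)) (ren-agree f g q (a ∘ ∈-++⁺ʳ (fn P)))
    ren-agree f g lin-𝟎 a = α-refl

    -- Agreement is assumed only off the bound name, which may coincide with the subject. Hence the
    -- subject stays as it is here, and `ren-agree` equates the two subjects beforehand.
    rebind-agree : ∀ f g → Linear P → AgreeOn (fn P ∖ bnAct π) f g →
                   rebindAct f π ∙ ren f P =α rebindAct g π ∙ ren g P
    rebind-agree {P} {send x y} f g p a
      with z , z∉ ← infinite (map (f ·_) (fn P) ++ map (g ·_) (fn P)) =
      α-trans (send-rename (∉-map⇒∉-ren f P (∉-++⁻ˡ z∉)))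
      (α-trans (∙-cong (swap-agree {y = y} f g p a z∉))
      (α-sym (send-rename (∉-map⇒∉-ren g P (∉-++⁻ʳ (map (f ·_) (fn P)) z∉)))))
    rebind-agree {P} {recv x y} f g p a
      with z , z∉ ← infinite (map (f ·_) (fn P) ++ map (g ·_) (fn P)) =
      α-trans (recv-rename (∉-map⇒∉-ren f P (∉-++⁻ˡ z∉)))
      (α-trans (∙-cong (swap-agree {y = y} f g p a z∉))
      (α-sym (recv-rename (∉-map⇒∉-ren g P (∉-++⁻ʳ (map (f ·_) (fn P)) z∉)))))
    rebind-agree {π = close x} f g p a = ∙-cong (ren-agree f g p (λ i → a (∈-∖⁺ i λ ())))
    rebind-agree {π = wait x}  f g p a = ∙-cong (ren-agree f g p (λ i → a (∈-∖⁺ i λ ())))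

    swap-agree : ∀ f g → Linear P → AgreeOn (fn P ∖ [ y ]) f g →
                 z ∉ map (f ·_) (fn P) ++ map (g ·_) (fn P) →
                 swap (f · y) z (ren f P) =α swap (g · y) z (ren g P)
    swap-agree {P} {y} {z} f g p a z∉
      rewrite swap-ren f (f · y) z P | swap-ren g (g · y) z P =
      ren-agree (transp (f · y) z ⊙ f) (transp (g · y) z ⊙ g) p
        (λ i → agree-transp {f = f} {g} [] a (∉-++⁻ˡ z∉) (∉-++⁻ʳ (map (f ·_) (fn P)) z∉)
                 (∈-∖⁺ i λ ()))

  bnAct-rebind : ∀ f π → bnAct (rebindAct f π) ≡ map (f ·_) (bnAct π)
  bnAct-rebind f (send x y) = refl
  bnAct-rebind f (recv x y) = refl
  bnAct-rebind f (close x)  = refl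
  bnAct-rebind f (wait x)   = refl

  rebindAct-⊙ : ∀ g f π → rebindAct g (rebindAct f π) ≡ rebindAct (g ⊙ f) π
  rebindAct-⊙ g f (send x y) = refl
  rebindAct-⊙ g f (recv x y) = refl
  rebindAct-⊙ g f (close x)  = refl
  rebindAct-⊙ g f (wait x)   = refl

  rebindAct-id : ∀ f π → f fixes bnAct π → rebindAct f π ≡ π
  rebindAct-id f (send x y) e = cong (send x) (e (here refl))
  rebindAct-id f (recv x y) e = cong (recv x) (e (here refl))
  rebindAct-id f (close x)  e = refl
  rebindAct-id f (wait x)   e = refl

  idₚ : Perm
  idₚ = ↔-refl

  ren-idₚ : ∀ P → ren idₚ P ≡ P
  ren-idₚ = ren-id idₚ (λ _ → refl)

  ren-fix : ∀ f → Linear P → f fixes fn P → ren f P =α P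
  ren-fix {P} f p fix = α-trans (ren-agree f idₚ p fix) (α-reflexive (ren-idₚ P))

  rebind-fix : ∀ f → Linear P → f fixes (fn P ∖ bnAct π) → rebindAct f π ∙ ren f P =α π ∙ P
  rebind-fix {P} {π} f p fix =
    α-trans (rebind-agree {π = π} f idₚ p fix)
            (α-reflexive (cong₂ _∙_ (rebindAct-id idₚ π (λ _ → refl)) (ren-idₚ P)))

  fixes-⁻¹ : ∀ f → f · n ≡ n → f ⁻¹ · n ≡ n
  fixes-⁻¹ f eq = trans (cong (f ⁻¹ ·_) (sym eq)) (⁻¹-· f)

  -- The second transposition starts from the image of `y` under the first, so that `y` goes to `w`
  -- even if `y` is `z`.
  move : (x y z w : Name) → Perm
  move x y z w = transp (swapName x z y) w ⊙ transp x z

  move-fst : x ≢ y → z ≢ w → move x y z w · x ≡ z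
  move-fst {x} {y} {z} {w} x≢y z≢w rewrite swapName-left x z =
    swapName-other (λ e → x≢y (·-injective (transp x z) (trans (swapName-left x z) e))) z≢w

  move-snd : ∀ x y z w → move x y z w · y ≡ w
  move-snd x y z w = swapName-left (swapName x z y) w

  move-other : n ≢ x → n ≢ y → n ≢ z → n ≢ w → move x y z w · n ≡ n
  move-other {n} {x} {y} {z} {w} n≢x n≢y n≢z n≢w rewrite swapName-other n≢x n≢z =
    swapName-other (λ e → n≢y (·-injective (transp x z) (trans (swapName-other n≢x n≢z) e))) n≢w

  ≢-of : n ∈ xs → z ∉ xs → n ≢ z
  ≢-of i z∉ refl = z∉ i

  freshen : x ≢ y → ∀ L → ∃[ f ] f · x ∉ L × f · y ∉ L × f fixes (L ∖ (x ∷ y ∷ []))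
  freshen {x} {y} x≢y L with z , z∉ ← infinite L with w , w∉ ← infinite (z ∷ L) =
    move x y z w ,
    subst (_∉ L) (sym (move-fst x≢y (w∉ ∘ here ∘ sym))) z∉ ,
    subst (_∉ L) (sym (move-snd x y z w)) (w∉ ∘ there) ,
    λ i → let j , n∉ = ∈-∖⁻ {xs = L} i in
      move-other (n∉ ∘ here) (n∉ ∘ there ∘ here) (≢-of j z∉) (≢-of j (w∉ ∘ there))

  -- Inversion of α-equivalence

  -- The bodies are related by one bijection fixing what is free under the binder, instead of by
  -- freshness conditions on the new names. Inverses and composites of such bijections then give
  -- closure under `α-sym` and `α-trans`. The disjunction in `head-ν` accounts for `ν-comm`.
  data Head : Proc → Proc → Set where
    head-∙ : ∀ f → π′ ≡ rebindAct f π → f fixes (fn P ∖ bnAct π) → ren f P =α P′ →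
             Head (π ∙ P) (π′ ∙ P′)
    head-ν : ∀ f → (z ≡ f · x × w ≡ f · y) ⊎ (z ≡ f · y × w ≡ f · x) →
             f fixes fn (ν x y P) → ren f P =α P′ → Head (ν x y P) (ν z w P′)
    head-∥ : P =α P′ → Q =α Q′ → Head (P ∥ Q) (P′ ∥ Q′)
    head-𝟎 : Head 𝟎 𝟎

  head-refl : ∀ P → Head P P
  head-refl (π ∙ P)   = head-∙ idₚ (sym (rebindAct-id idₚ π (λ _ → refl))) (λ _ → refl)
                          (α-reflexive (ren-idₚ P))
  head-refl (ν x y P) = head-ν idₚ (inj₁ (refl , refl)) (λ _ → refl) (α-reflexive (ren-idₚ P))
  head-refl (P ∥ Q)   = head-∥ α-refl α-refl
  head-refl 𝟎         = head-𝟎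

  ren-α⁻¹ : ∀ f → ren f P =α Q → ren (f ⁻¹) Q =α P
  ren-α⁻¹ {P} f p = α-trans (ren-α (f ⁻¹) (α-sym p)) (α-reflexive (ren-⁻¹ f P))

  ren-α-⊙ : ∀ g f → ren f P =α Q → ren g Q =α R → ren (g ⊙ f) P =α R
  ren-α-⊙ {P} g f p q = α-trans (α-reflexive (sym (ren-⊙ g f P))) (α-trans (ren-α g p) q)

  fn-∖-α : P =α Q → n ∈ fn P ∖ ys → n ∈ fn Q ∖ ys
  fn-∖-α {P} {Q} p = fn-∖ {P = P} {Q} (proj₁ (fn-α p))

  -- The α-equivalence is an extra argument so that, in the case of `ν`, `fn-α` can transfer the
  -- fixed names to the other side.
  head-sym : P =α Q → Head P Q → Head Q P
  head-sym _ (head-∙ {π = π} {P} {P′} f refl fix p) =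
    head-∙ (f ⁻¹)
      (sym (trans (rebindAct-⊙ (f ⁻¹) f π) (rebindAct-id (f ⁻¹ ⊙ f) π (λ _ → ⁻¹-· f))))
      (λ i → fixes-⁻¹ f (fix (fn-abs-ren⁻ f P fix
        (subst (λ ys → _ ∈ fn (ren f P) ∖ ys) (bnAct-rebind f π)
          (fn-∖-α (α-sym p) i)))))
      (ren-α⁻¹ f p)
  head-sym q (head-ν f (inj₁ (refl , refl)) fix p) =
    head-ν (f ⁻¹) (inj₁ (sym (⁻¹-· f) , sym (⁻¹-· f)))
      (λ i → fixes-⁻¹ f (fix (proj₂ (fn-α q) i))) (ren-α⁻¹ f p)
  head-sym q (head-ν f (inj₂ (refl , refl)) fix p) =
    head-ν (f ⁻¹) (inj₂ (sym (⁻¹-· f) , sym (⁻¹-· f)))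
      (λ i → fixes-⁻¹ f (fix (proj₂ (fn-α q) i))) (ren-α⁻¹ f p)
  head-sym _ (head-∥ p q) = head-∥ (α-sym p) (α-sym q)
  head-sym _ head-𝟎       = head-𝟎

  head-trans : P =α Q → Head P Q → Head Q R → Head P R
  head-trans _ (head-∙ {π = π} {P} f refl fix p) (head-∙ g refl fix′ p′) =
    head-∙ (g ⊙ f) (rebindAct-⊙ g f π)
      (λ i → trans (cong (g ·_) (fix i))
        (fix′ (fn-∖-α p (subst (λ ys → _ ∈ fn (ren f P) ∖ ys) (sym (bnAct-rebind f π))
          (fn-abs-ren⁺ f P fix i)))))
      (ren-α-⊙ g f p p′)
  head-trans q (head-ν f o fix p) (head-ν g o′ fix′ p′) =
    head-ν (g ⊙ f) (orient o o′)
      (λ i → trans (cong (g ·_) (fix i)) (fix′ (proj₁ (fn-α q) i))) (ren-α-⊙ g f p p′)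
    where
    orient : ∀ {x y z w x′ y′} → (z ≡ f · x × w ≡ f · y) ⊎ (z ≡ f · y × w ≡ f · x) →
             (x′ ≡ g · z × y′ ≡ g · w) ⊎ (x′ ≡ g · w × y′ ≡ g · z) →
             (x′ ≡ g · f · x × y′ ≡ g · f · y) ⊎ (x′ ≡ g · f · y × y′ ≡ g · f · x)
    orient (inj₁ (refl , refl)) o = o
    orient (inj₂ (refl , refl)) (inj₁ o) = inj₂ o
    orient (inj₂ (refl , refl)) (inj₂ o) = inj₁ o
  head-trans _ (head-∥ p q) (head-∥ p′ q′) = head-∥ (α-trans p p′) (α-trans q q′)
  head-trans _ head-𝟎 head-𝟎 = head-𝟎

  α⇒head : P =α Q → Head P Q
  α⇒head α-refl        = head-refl _
  α⇒head (α-sym p)     = head-sym p (α⇒head p)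
  α⇒head (α-trans p q) = head-trans p (α⇒head p) (α⇒head q)
  α⇒head (∙-cong {π} {P} p) =
    head-∙ idₚ (sym (rebindAct-id idₚ π (λ _ → refl))) (λ _ → refl)
      (α-trans (α-reflexive (ren-idₚ P)) p)
  α⇒head (ν-cong {P = P} p) =
    head-ν idₚ (inj₁ (refl , refl)) (λ _ → refl) (α-trans (α-reflexive (ren-idₚ P)) p)
  α⇒head (∥-cong p q) = head-∥ p q
  α⇒head (send-rename {x} {y} {z} {P} z∉) =
    head-∙ (transp y z) (cong (send x) (sym (swapName-left y z))) (transp-fixes {P = P} z∉ [])
      (α-reflexive (sym (swap≡ren y z P)))
  α⇒head (recv-rename {x} {y} {z} {P} z∉) =
    head-∙ (transp y z) (cong (recv x) (sym (swapName-left y z))) (transp-fixes {P = P} z∉ [])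
      (α-reflexive (sym (swap≡ren y z P)))
  α⇒head (ν-rename {x} {y} {z} {P} x≢y z≢y z∉) =
    head-ν (transp x z)
      (inj₁ (sym (swapName-left x z) , sym (swapName-other (x≢y ∘ sym) (z≢y ∘ sym))))
      (transp-fixes {P = P} z∉ (y ∷ [])) (α-reflexive (sym (swap≡ren x z P)))
  α⇒head (ν-comm {P = P}) =
    head-ν idₚ (inj₂ (refl , refl)) (λ _ → refl) (α-reflexive (ren-idₚ P))

  -- Transitions

  map-++-· : ∀ f xs → map (f ·_) (xs ++ ys) ≡ map (f ·_) xs ++ map (f ·_) ys
  map-++-· f xs = map-++ (f ·_) xs _

  bnL-ren : ∀ f l → bnL (renLabel f l) ≡ map (f ·_) (bnL l)
  bnL-ren f τ           = refl
  bnL-ren f (act l)     = bnAct-renAct f l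
  bnL-ren f (pair l l′) =
    trans (cong₂ _++_ (bnAct-renAct f l) (bnAct-renAct f l′)) (sym (map-++-· f (bnAct l)))

  fnL-ren : ∀ f l → fnL (renLabel f l) ≡ map (f ·_) (fnL l)
  fnL-ren f τ           = refl
  fnL-ren f (act l)     = fnAct-renAct f l
  fnL-ren f (pair l l′) =
    trans (cong₂ _++_ (fnAct-renAct f l) (fnAct-renAct f l′)) (sym (map-++-· f (fnAct l)))

  cn-ren : ∀ f l → cn (renLabel f l) ≡ map (f ·_) (cn l)
  cn-ren f l = trans (cong₂ _++_ (fnL-ren f l) (bnL-ren f l)) (sym (map-++-· f (fnL l)))

  bnL-rebind : ∀ f l → bnL (rebind f l) ≡ map (f ·_) (bnL l)
  bnL-rebind f τ           = refl
  bnL-rebind f (act l)     = bnAct-rebind f l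
  bnL-rebind f (pair l l′) =
    trans (cong₂ _++_ (bnAct-rebind f l) (bnAct-rebind f l′)) (sym (map-++-· f (bnAct l)))

  fnAct-rebind : ∀ f π → fnAct (rebindAct f π) ≡ fnAct π
  fnAct-rebind f (send x y) = refl
  fnAct-rebind f (recv x y) = refl
  fnAct-rebind f (close x)  = refl
  fnAct-rebind f (wait x)   = refl

  fnL-rebind : ∀ f l → fnL (rebind f l) ≡ fnL l
  fnL-rebind f τ           = refl
  fnL-rebind f (act l)     = fnAct-rebind f l
  fnL-rebind f (pair l l′) = cong₂ _++_ (fnAct-rebind f l) (fnAct-rebind f l′)

  ∉-map-· : ∀ f → n ∉ xs → f · n ∉ map (f ·_) xs
  ∉-map-· f n∉ = n∉ ∘ ∈-map-· f

  ren-disjoint : ∀ f l P → Disjoint (bnL l) (fn P) → Disjoint (bnL (renLabel f l)) (fn (ren f P))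
  ren-disjoint f l P d rewrite bnL-ren f l = Disjoint-fn-ren {P = P} f d

  ∉-cn-ren : ∀ f l → n ∉ cn l → f · n ∉ cn (renLabel f l)
  ∉-cn-ren f l n∉ rewrite cn-ren f l = ∉-map-· f n∉

  ren-step : ∀ f → P ─⟨ l ⟩→ P′ → ren f P ─⟨ renLabel f l ⟩→ ren f P′
  ren-step f prefix      = prefix
  ren-step f (alpha p s) = alpha (ren-α f p) (ren-step f s)
  ren-step f (par₁ {Q = Q} {l = l} d s) = par₁ (ren-disjoint f l Q d) (ren-step f s)
  ren-step f (par₂ {P = P} {l = l} d s) = par₂ (ren-disjoint f l P d) (ren-step f s)
  ren-step f (syn {P} {Q = Q} {l = l} {l′} d d₁ d₂ s s′) =
    syn (subst₂ Disjoint (sym (bnAct-renAct f l)) (sym (bnAct-renAct f l′)) (Disjoint-map f d))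
        (ren-disjoint f (act l) Q d₁) (ren-disjoint f (act l′) P d₂) (ren-step f s) (ren-step f s′)
  ren-step f (pair-comm s) = pair-comm (ren-step f s)
  ren-step f (res {l = l} x∉ y∉ s) = res (∉-cn-ren f l x∉) (∉-cn-ren f l y∉) (ren-step f s)
  ren-step f (com-unit s) = com-unit (ren-step f s)
  ren-step f (com s)      = com (ren-step f s)

  ∈-++-comm : ∀ xs → n ∈ xs ++ ys → n ∈ ys ++ xs
  ∈-++-comm {ys = ys} xs i with ∈-++⁻ xs i
  ... | inj₁ j = ∈-++⁺ʳ ys j
  ... | inj₂ j = ∈-++⁺ˡ j

  ∉-cn-comm : ∀ π π′ → n ∉ cn (pair π π′) → n ∉ cn (pair π′ π)
  ∉-cn-comm π π′ n∉ i with cn-pair π′ π i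
  ... | inj₁ j = n∉ (pair-cnʳ π π′ j)
  ... | inj₂ j = n∉ (pair-cnˡ π π′ j)

  fnL⊆fn : P ─⟨ l ⟩→ P′ → n ∈ fnL l → n ∈ fn P
  fnL⊆fn prefix i = ∈-++⁺ˡ i
  fnL⊆fn (alpha p s) i = proj₂ (fn-α p) (fnL⊆fn s i)
  fnL⊆fn (par₁ _ s) i = ∈-++⁺ˡ (fnL⊆fn s i)
  fnL⊆fn (par₂ {P} _ s) i = ∈-++⁺ʳ (fn P) (fnL⊆fn s i)
  fnL⊆fn (syn {P} {l = l} _ _ _ s s′) i with ∈-++⁻ (fnAct l) i
  ... | inj₁ j = ∈-++⁺ˡ (fnL⊆fn s j)
  ... | inj₂ j = ∈-++⁺ʳ (fn P) (fnL⊆fn s′ j)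
  fnL⊆fn (pair-comm {l′ = l′} s) i = fnL⊆fn s (∈-++-comm (fnAct l′) i)
  fnL⊆fn (res x∉ y∉ s) i = ∈-∖⁺ (fnL⊆fn s i)
    λ { (here refl) → x∉ (∈-++⁺ˡ i) ; (there (here refl)) → y∉ (∈-++⁺ˡ i) }

  closedL : Label → List Name
  closedL τ           = []
  closedL (act l)     = closedAct l
  closedL (pair l l′) = closedAct l ++ closedAct l′

  closed⊆fnAct : ∀ π → n ∈ closedAct π → n ∈ fnAct π
  closed⊆fnAct (close x) i = i
  closed⊆fnAct (wait x)  i = i

  closed⊆fnL : ∀ l → n ∈ closedL l → n ∈ fnL l
  closed⊆fnL (act l)     i = closed⊆fnAct l i
  closed⊆fnL (pair l l′) i with ∈-++⁻ (closedAct l) i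
  ... | inj₁ j = ∈-++⁺ˡ (closed⊆fnAct l j)
  ... | inj₂ j = ∈-++⁺ʳ (fnAct l) (closed⊆fnAct l′ j)

  fn-ν⁻ : ∀ P → n ∈ fn (ν x y P) → n ∈ fn P × n ≢ x × n ≢ y
  fn-ν⁻ P i with j , n∉ ← ∈-∖⁻ {xs = fn P} i = j , n∉ ∘ here , n∉ ∘ there ∘ here

  fn-ν⁺ : ∀ P → n ∈ fn P → n ≢ x → n ≢ y → n ∈ fn (ν x y P)
  fn-ν⁺ P i n≢x n≢y = ∈-∖⁺ i λ { (here e) → n≢x e ; (there (here e)) → n≢y e }

  fst∉fn-ν : ∀ P → x ∉ fn (ν x y P)
  fst∉fn-ν P i = proj₁ (proj₂ (fn-ν⁻ P i)) refl

  snd∉fn-ν : ∀ P → y ∉ fn (ν x y P)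
  snd∉fn-ν P i = proj₂ (proj₂ (fn-ν⁻ P i)) refl

  mutual
    -- The case `com-unit` forces a joint induction with `closed-step`: the restriction disappears
    -- there, so its two names must not survive in the target. That a closed name does not survive
    -- `syn` needs in turn a bound on the free names of the other component's target.
    fn-step : Linear P → P ─⟨ l ⟩→ P′ → n ∈ fn P′ → n ∈ fn P ⊎ n ∈ bnL l
    fn-step {n = n} p (prefix {π}) i with n ∈? bnAct π
    ... | yes j = inj₂ j
    ... | no n∉ = inj₁ (∈-++⁺ʳ (fnAct π) (∈-∖⁺ i n∉))
    fn-step p (alpha q s) i with fn-step (proj₁ (linear-α q) p) s i
    ... | inj₁ j = inj₁ (proj₂ (fn-α q) j)
    ... | inj₂ j = inj₂ j
    fn-step (lin-∥ {P} _ p q) (par₁ {P′ = P′} _ s) i with ∈-++⁻ (fn P′) i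
    ... | inj₂ j = inj₁ (∈-++⁺ʳ (fn P) j)
    ... | inj₁ j with fn-step p s j
    ...   | inj₁ k = inj₁ (∈-++⁺ˡ k)
    ...   | inj₂ k = inj₂ k
    fn-step (lin-∥ {P} _ p q) (par₂ _ s) i with ∈-++⁻ (fn P) i
    ... | inj₁ j = inj₁ (∈-++⁺ˡ j)
    ... | inj₂ j with fn-step q s j
    ...   | inj₁ k = inj₁ (∈-++⁺ʳ (fn P) k)
    ...   | inj₂ k = inj₂ k
    fn-step (lin-∥ {P} _ p q) (syn {P′ = P′} {l = l} _ _ _ s s′) i with ∈-++⁻ (fn P′) i
    ... | inj₁ j with fn-step p s j
    ...   | inj₁ k = inj₁ (∈-++⁺ˡ k)
    ...   | inj₂ k = inj₂ (∈-++⁺ˡ k)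
    fn-step (lin-∥ {P} _ p q) (syn {P′ = P′} {l = l} _ _ _ s s′) i | inj₂ j with fn-step q s′ j
    ...   | inj₁ k = inj₁ (∈-++⁺ʳ (fn P) k)
    ...   | inj₂ k = inj₂ (∈-++⁺ʳ (bnAct l) k)
    fn-step p (pair-comm {l = l} s) i with fn-step p s i
    ... | inj₁ j = inj₁ j
    ... | inj₂ j = inj₂ (∈-++-comm (bnAct l) j)
    fn-step (lin-ν {P = P} x≢y p) (res {P′ = P′} _ _ s) i
      with j , n≢x , n≢y ← fn-ν⁻ P′ i with fn-step p s j
    ... | inj₁ k = inj₁ (fn-ν⁺ P k n≢x n≢y)
    ... | inj₂ k = inj₂ k
    fn-step (lin-ν {P = P} x≢y p) (com-unit s) i with fn-step p s i
    ... | inj₁ j = inj₁ (fn-ν⁺ P j (λ { refl → closed-step p s (here refl) i })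
                                 (λ { refl → closed-step p s (there (here refl)) i }))
    fn-step (lin-ν {P = P} x≢y p) (com {x′ = x′} {y′} {P′ = P′} s) i
      with i′ , n≢x , n≢y ← fn-ν⁻ (ν x′ y′ P′) i
      with j , n≢x′ , n≢y′ ← fn-ν⁻ P′ i′ with fn-step p s j
    ... | inj₁ k = inj₁ (fn-ν⁺ P k n≢x n≢y)
    ... | inj₂ (here e) = contradiction e n≢x′
    ... | inj₂ (there (here e)) = contradiction e n≢y′

    closed-step : Linear P → P ─⟨ l ⟩→ P′ → n ∈ closedL l → n ∉ fn P′
    closed-step (lin-∙ d p) prefix c i = d (c , i)
    closed-step p (alpha q s) c i = closed-step (proj₁ (linear-α q) p) s c i
    closed-step (lin-∥ d p q) (par₁ {P′ = P′} {l = l} _ s) c i with ∈-++⁻ (fn P′) i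
    ... | inj₁ j = closed-step p s c j
    ... | inj₂ j = d (fnL⊆fn s (closed⊆fnL l c) , j)
    closed-step (lin-∥ {P} d p q) (par₂ {l = l} _ s) c i with ∈-++⁻ (fn P) i
    ... | inj₁ j = d (j , fnL⊆fn s (closed⊆fnL l c))
    ... | inj₂ j = closed-step q s c j
    closed-step (lin-∥ d p q) (syn {P′ = P′} {l = l} {l′} _ d₁ d₂ s s′) c i
      with ∈-++⁻ (closedAct l) c | ∈-++⁻ (fn P′) i
    ... | inj₁ c′ | inj₁ j = closed-step p s c′ j
    ... | inj₂ c′ | inj₂ j = closed-step q s′ c′ j
    ... | inj₁ c′ | inj₂ j with fn-step q s′ j
    ...   | inj₁ k = d (fnL⊆fn s (closed⊆fnAct l c′) , k)
    ...   | inj₂ k = d₂ (k , fnL⊆fn s (closed⊆fnAct l c′))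
    closed-step (lin-∥ d p q) (syn {P′ = P′} {l = l} {l′} _ d₁ d₂ s s′) c i
      | inj₂ c′ | inj₁ j with fn-step p s j
    ...   | inj₁ k = d (k , fnL⊆fn s′ (closed⊆fnAct l′ c′))
    ...   | inj₂ k = d₁ (k , fnL⊆fn s′ (closed⊆fnAct l′ c′))
    closed-step p (pair-comm {l′ = l′} s) c i = closed-step p s (∈-++-comm (closedAct l′) c) i
    closed-step (lin-ν x≢y p) (res {P′ = P′} _ _ s) c i =
      closed-step p s c (proj₁ (fn-ν⁻ P′ i))

  pair-disjoint : P ─⟨ pair π π′ ⟩→ P′ → Disjoint (bnAct π) (bnAct π′)
  pair-disjoint (alpha _ s)         = pair-disjoint s
  pair-disjoint (par₁ _ s)          = pair-disjoint s
  pair-disjoint (par₂ _ s)          = pair-disjoint s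
  pair-disjoint (syn d _ _ _ _)     = d
  pair-disjoint (pair-comm s) (i , j) = pair-disjoint s (j , i)
  pair-disjoint (res _ _ s)         = pair-disjoint s

  -- Every pair label originates in `syn`, whose first premise separates the bound names. This makes
  -- the restriction created by `com` linear.
  com-≢ : P ─⟨ pair (send x z) (recv y w) ⟩→ P′ → z ≢ w
  com-≢ s refl = pair-disjoint s (here refl , here refl)

  linear-step : Linear P → P ─⟨ l ⟩→ P′ → Linear P′
  linear-step (lin-∙ _ p) prefix = p
  linear-step p (alpha q s) = linear-step (proj₁ (linear-α q) p) s
  linear-step (lin-∥ d p q) (par₁ d′ s) = lin-∥ disjoint (linear-step p s) q
    where
    disjoint : Disjoint _ _
    disjoint (i , j) with fn-step p s i
    ... | inj₁ k = d (k , j)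
    ... | inj₂ k = d′ (k , j)
  linear-step (lin-∥ d p q) (par₂ d′ s) = lin-∥ disjoint p (linear-step q s)
    where
    disjoint : Disjoint _ _
    disjoint (i , j) with fn-step q s j
    ... | inj₁ k = d (i , k)
    ... | inj₂ k = d′ (k , i)
  linear-step (lin-∥ d p q) (syn d′ d₁ d₂ s s′) =
    lin-∥ disjoint (linear-step p s) (linear-step q s′)
    where
    disjoint : Disjoint _ _
    disjoint (i , j) with fn-step p s i | fn-step q s′ j
    ... | inj₁ k | inj₁ m = d (k , m)
    ... | inj₁ k | inj₂ m = d₂ (m , k)
    ... | inj₂ k | inj₁ m = d₁ (k , m)
    ... | inj₂ k | inj₂ m = d′ (k , m)
  linear-step p (pair-comm s) = linear-step p s
  linear-step (lin-ν x≢y p) (res _ _ s) = lin-ν x≢y (linear-step p s)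
  linear-step (lin-ν x≢y p) (com-unit s) = linear-step p s
  linear-step (lin-ν x≢y p) (com s) = lin-ν x≢y (lin-ν (com-≢ s) (linear-step p s))

  -- Inversion of transitions

  -- Relating whole prefixed processes by `=α` lets successive uses of `alpha` compose by
  -- transitivity; the bound name is analysed only once, where the lemma is applied.
  ∙-inv : π ∙ P ─⟨ l ⟩→ S → ∃[ π′ ] l ≡ act π′ × π ∙ P =α π′ ∙ S
  ∙-inv prefix = _ , refl , α-refl
  ∙-inv (alpha p s) with α⇒head p
  ... | head-∙ _ _ _ _ with π′ , eq , q ← ∙-inv s = π′ , eq , α-trans p q
  ∙-inv (pair-comm s) with () ← proj₁ (proj₂ (∙-inv s))

  𝟎-inv : ¬ (𝟎 ─⟨ l ⟩→ S)
  𝟎-inv (alpha p s) with head-𝟎 ← α⇒head p = 𝟎-inv s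
  𝟎-inv (pair-comm s) = 𝟎-inv s

  -- Targets are taken up to `=α` because `alpha` may also replace the idle component; `both` allows
  -- either order of the pair because of `pair-comm`.
  data ParStep (P Q : Proc) : Label → Proc → Set where
    left  : Disjoint (bnL l) (fn Q) → P ─⟨ l ⟩→ P′ → P′ ∥ Q =α S → ParStep P Q l S
    right : Disjoint (bnL l) (fn P) → Q ─⟨ l ⟩→ Q′ → P ∥ Q′ =α S → ParStep P Q l S
    both  : Disjoint (bnAct π) (bnAct π′) → Disjoint (bnAct π) (fn Q) →
            Disjoint (bnAct π′) (fn P) → P ─⟨ act π ⟩→ P′ → Q ─⟨ act π′ ⟩→ Q′ →
            P′ ∥ Q′ =α S → l ≡ pair π π′ ⊎ l ≡ pair π′ π → ParStep P Q l S

  disjoint-α : P =α Q → Disjoint xs (fn P) → Disjoint xs (fn Q)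
  disjoint-α p d (i , j) = d (i , proj₂ (fn-α p) j)

  ∥-inv : P ∥ Q ─⟨ l ⟩→ S → ParStep P Q l S
  ∥-inv (alpha r s) with head-∥ p q ← α⇒head r with ∥-inv s
  ... | left d t e  = left (disjoint-α (α-sym q) d) (alpha p t) (α-trans (∥-cong α-refl q) e)
  ... | right d t e = right (disjoint-α (α-sym p) d) (alpha q t) (α-trans (∥-cong p α-refl) e)
  ... | both d d₁ d₂ t u e o =
    both d (disjoint-α (α-sym q) d₁) (disjoint-α (α-sym p) d₂) (alpha p t) (alpha q u) e o
  ∥-inv (par₁ d s) = left d s α-refl
  ∥-inv (par₂ d s) = right d s α-refl
  ∥-inv (syn d d₁ d₂ s s′) = both d d₁ d₂ s s′ α-refl (inj₁ refl)
  ∥-inv (pair-comm {l = l} {l′} s) with ∥-inv s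
  ... | left d t e  = left (λ (i , j) → d (∈-++-comm (bnAct l′) i , j)) (pair-comm t) e
  ... | right d t e = right (λ (i , j) → d (∈-++-comm (bnAct l′) i , j)) (pair-comm t) e
  ... | both d d₁ d₂ t u e (inj₁ refl) = both d d₁ d₂ t u e (inj₂ refl)
  ... | both d d₁ d₂ t u e (inj₂ refl) = both d d₁ d₂ t u e (inj₁ refl)

  syn-either : Disjoint (bnAct π) (bnAct π′) → Disjoint (bnAct π) (fn Q) →
               Disjoint (bnAct π′) (fn P) → P ─⟨ act π ⟩→ P′ → Q ─⟨ act π′ ⟩→ Q′ →
               l ≡ pair π π′ ⊎ l ≡ pair π′ π → P ∥ Q ─⟨ l ⟩→ P′ ∥ Q′
  syn-either d d₁ d₂ s s′ (inj₁ refl) = syn d d₁ d₂ s s′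
  syn-either d d₁ d₂ s s′ (inj₂ refl) = pair-comm (syn d d₁ d₂ s s′)

  -- What is left of the rules for `ν` once `alpha` and `pair-comm` have been absorbed.
  data NuStep (x y : Name) (P : Proc) : Label → Proc → Set where
    nu-res  : x ∉ cn l → y ∉ cn l → P ─⟨ l ⟩→ P′ → NuStep x y P l (ν x y P′)
    nu-unit : P ─⟨ pair (close x) (wait y) ⟩→ P′ → NuStep x y P τ P′
    nu-com  : P ─⟨ pair (send x z) (recv y w) ⟩→ P′ → NuStep x y P τ (ν x y (ν z w P′))

  nu-ren : ∀ f → NuStep x y P l S → NuStep (f · x) (f · y) (ren f P) (renLabel f l) (ren f S)
  nu-ren f (nu-res {l = l} x∉ y∉ s) =
    nu-res (∉-cn-ren f l x∉) (∉-cn-ren f l y∉) (ren-step f s)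
  nu-ren f (nu-unit s)      = nu-unit (ren-step f s)
  nu-ren f (nu-com s)       = nu-com (ren-step f s)

  nu-α : P =α Q → NuStep x y Q l S → NuStep x y P l S
  nu-α p (nu-res x∉ y∉ s) = nu-res x∉ y∉ (alpha p s)
  nu-α p (nu-unit s)      = nu-unit (alpha p s)
  nu-α p (nu-com s)       = nu-com (alpha p s)

  nu-∉cn : NuStep x y P l S → x ∉ cn l × y ∉ cn l
  nu-∉cn (nu-res x∉ y∉ _) = x∉ , y∉
  nu-∉cn (nu-unit _)      = (λ ()) , (λ ())
  nu-∉cn (nu-com _)       = (λ ()) , (λ ())

  nu-∉fn : Linear P → NuStep x y P l S → x ∉ fn S × y ∉ fn S
  nu-∉fn p (nu-res {P′ = P′} _ _ _) = fst∉fn-ν P′ , snd∉fn-ν P′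
  nu-∉fn p (nu-unit s) = closed-step p s (here refl) , closed-step p s (there (here refl))
  nu-∉fn p (nu-com {z} {w} {P′} _) = fst∉fn-ν (ν z w P′) , snd∉fn-ν (ν z w P′)

  ν-inv : ν x y P ─⟨ l ⟩→ S → ∃[ z ] ∃[ w ] ∃[ Q ] ν x y P =α ν z w Q × NuStep z w Q l S
  ν-inv (alpha p s) with head-ν _ _ _ _ ← α⇒head p
    with z , w , Q , q , t ← ν-inv s = z , w , Q , α-trans p q , t
  ν-inv (pair-comm {l = l} {l′} s) with z , w , Q , q , nu-res z∉ w∉ t ← ν-inv s =
    z , w , Q , q , nu-res (∉-cn-comm l l′ z∉) (∉-cn-comm l l′ w∉) (pair-comm t)
  ν-inv (res x∉ y∉ s) = _ , _ , _ , α-refl , nu-res x∉ y∉ s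
  ν-inv (com-unit s)  = _ , _ , _ , α-refl , nu-unit s
  ν-inv (com s)       = _ , _ , _ , α-refl , nu-com s

  -- The binders of the transition found by inversion can be moved back to x and
  -- y because neither these nor the original ones occur in the label or in S.
  nu-restore : ∀ f → Linear (ν x y P) → x ∉ cn l → y ∉ cn l → f fixes fn (ν x y P) →
               ren f P =α Q → ν x y P ─⟨ l ⟩→ S → NuStep (f · x) (f · y) Q l S →
               ∃[ S′ ] NuStep x y P l S′ × S′ =α S
  nu-restore {x} {y} {P} {l} {Q} {S} f (lin-ν x≢y p) x∉ y∉ fix q s t =
    ren g S , nu-α (α-sym (α-trans (ren-α g (α-sym q)) back)) t′ ,
    ren-fix g (linear-step (lin-ν x≢y p) s) g-fixes-S
    where
    g = move (f · x) (f · y) x y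
    fx≢fy : f · x ≢ f · y
    fx≢fy = x≢y ∘ ·-injective f
    gfx : g · f · x ≡ x
    gfx = move-fst fx≢fy x≢y
    gfy : g · f · y ≡ y
    gfy = move-snd (f · x) (f · y) x y
    g-fixes-l : g fixes cn l
    g-fixes-l i = move-other (≢-of i (proj₁ (nu-∉cn t))) (≢-of i (proj₂ (nu-∉cn t)))
                             (≢-of i x∉) (≢-of i y∉)
    ∉S : ∀ {n} → n ∉ cn l → n ∉ fn (ν x y P) → n ∉ fn S
    ∉S n∉ n∉′ i with fn-step (lin-ν x≢y p) s i
    ... | inj₁ j = n∉′ j
    ... | inj₂ j = n∉ (∈-++⁺ʳ (fnL l) j)
    linear-Q : Linear Q
    linear-Q = proj₁ (linear-α q) (ren-linear f p)
    g-fixes-S : g fixes fn S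
    g-fixes-S i = move-other (≢-of i (proj₁ (nu-∉fn linear-Q t))) (≢-of i (proj₂ (nu-∉fn linear-Q t)))
      (≢-of i (∉S x∉ (fst∉fn-ν P))) (≢-of i (∉S y∉ (snd∉fn-ν P)))
    t′ : NuStep x y (ren g Q) l (ren g S)
    t′ with t″ ← nu-ren g t rewrite gfx | gfy | renLabel-fix g l g-fixes-l = t″
    g⊙f-fixes : (g ⊙ f) fixes fn P
    g⊙f-fixes {n} i with n ≟ x
    ... | yes refl = gfx
    ... | no n≢x with n ≟ y
    ...   | yes refl = gfy
    -- `f` fixes `n`, so by injectivity `n` is neither `f · x` nor `f · y`, and `g` does not move it
    -- either.
    ...   | no n≢y with eq ← fix (fn-ν⁺ P i n≢x n≢y) = trans (cong (g ·_) eq)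
      (move-other (n≢x ∘ ·-injective f ∘ trans eq) (n≢y ∘ ·-injective f ∘ trans eq) n≢x n≢y)
    back : ren g (ren f P) =α P
    back = α-trans (α-reflexive (ren-⊙ g f P)) (ren-fix (g ⊙ f) p g⊙f-fixes)

  -- The second alternative arises when the α-equivalence has exchanged the binders; in a
  -- synchronisation, `y` is then on the sending or closing side.
  ν-inv-fresh : Linear (ν x y P) → x ∉ cn l → y ∉ cn l → ν x y P ─⟨ l ⟩→ S →
                (∃[ S′ ] NuStep x y P l S′ × S′ =α S) ⊎ (∃[ S′ ] NuStep y x P l S′ × S′ =α S)
  ν-inv-fresh {x} {y} {P} (lin-ν x≢y p) x∉ y∉ s with z , w , Q , q , t ← ν-inv s with α⇒head q
  ... | head-ν f (inj₁ (refl , refl)) fix e =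
    inj₁ (nu-restore f (lin-ν x≢y p) x∉ y∉ fix e s t)
  ... | head-ν f (inj₂ (refl , refl)) fix e =
    inj₂ (nu-restore f (lin-ν (x≢y ∘ sym) p) y∉ x∉ (fix ∘ fn-ν-comm {P = P}) e (alpha ν-comm s) t)

  -- Renaming the bound names of a label

  Avoids : Perm → List Name → List Name → Set
  Avoids f ys L = ∀ {n} → n ∈ ys → f · n ∉ L

  record Renames (f : Perm) (ys L : List Name) : Set where
    field
      fixed : n ∈ L → n ∉ ys → f · n ≡ n
      fresh : Avoids f ys L
  open Renames

  renames-⊆ : ∀ {f L′} → (∀ {n} → n ∈ L′ → n ∈ L) → Renames f ys L → Renames f ys L′
  renames-⊆ h r .fixed i = r .fixed (h i)
  renames-⊆ h r .fresh i = r .fresh i ∘ h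

  single : Perm → Act → Perm
  single f (send x y) = transp y (f · y)
  single f (recv x y) = transp y (f · y)
  single f (close x)  = idₚ
  single f (wait x)   = idₚ

  single-bound : ∀ f π → AgreeOn (bnAct π) (single f π) f
  single-bound f (send x y) (here refl) = swapName-left y (f · y)
  single-bound f (recv x y) (here refl) = swapName-left y (f · y)

  single-other : ∀ f π → n ∉ bnAct π → n ∉ map (f ·_) (bnAct π) → single f π · n ≡ n
  single-other f (send x y) a b = swapName-other (a ∘ here) (b ∘ here)
  single-other f (recv x y) a b = swapName-other (a ∘ here) (b ∘ here)
  single-other f (close x)  a b = refl
  single-other f (wait x)   a b = refl

  rebindAct-agree : ∀ f g π → AgreeOn (bnAct π) f g → rebindAct f π ≡ rebindAct g π
  rebindAct-agree f g (send x y) a = cong (send x) (a (here refl))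
  rebindAct-agree f g (recv x y) a = cong (recv x) (a (here refl))
  rebindAct-agree f g (close x)  a = refl
  rebindAct-agree f g (wait x)   a = refl

  avoids-map : ∀ {f} → Avoids f ys L → n ∈ L → n ∉ map (f ·_) ys
  avoids-map {f = f} a i j with m , m∈ , refl ← ∈-map⁻ (f ·_) j = a m∈ i

  single-renames : ∀ f π → Avoids f (bnAct π) L → Renames (single f π) (bnAct π) L
  single-renames f π a .fixed i n∉ = single-other f π n∉ (avoids-map {f = f} a i)
  single-renames f π a .fresh i rewrite single-bound f π i = a i

  -- `L` is extracted from the derivation. It contains the binders of `res` in the α-variants passed
  -- through, which need not occur in `P` at all; being finite, it still leaves fresh names to
  -- choose.
  Rebindable : Proc → Label → Proc → List Name → Set
  Rebindable P l P′ L = ∀ f → Renames f (bnL l) L →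
    ∃[ P″ ] P ─⟨ rebind f l ⟩→ P″ × P″ =α ren f P′

  -- A bound name of the label of a parallel component may also be bound inside
  -- the other component, where f would move it: hence the detour through single.
  rebindable-single : Linear P → P ─⟨ act π ⟩→ P′ → Rebindable P (act π) P′ L →
    ∀ f → Avoids f (bnAct π) L → Avoids f (bnAct π) (fn P) → f fixes (fn P ∖ bnAct π) →
    ∃[ P″ ] P ─⟨ act (rebindAct f π) ⟩→ P″ × P″ =α ren f P′
  rebindable-single {P} {π} {P′} p s h f a b fix
    with P″ , s′ , e ← h (single f π) (single-renames f π a)
    rewrite rebindAct-agree (single f π) f π (single-bound f π) =
    P″ , s′ , α-trans e (ren-agree (single f π) f (linear-step p s) agree)
    where
    agree : AgreeOn (fn P′) (single f π) f
    agree {n} i with n ∈? bnAct π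
    ... | yes j = single-bound f π j
    ... | no n∉ with fn-step p s i
    ...   | inj₁ k = trans (single-other f π n∉ (avoids-map {f = f} b k)) (sym (fix (∈-∖⁺ k n∉)))
    ...   | inj₂ k = contradiction k n∉

  rebind-disjoint : ∀ f l → Avoids f (bnL l) xs → Disjoint (bnL (rebind f l)) xs
  rebind-disjoint f l a (i , j) rewrite bnL-rebind f l = avoids-map {f = f} a j i

  rebind-∉cn : ∀ f l → Avoids f (bnL l) L → n ∈ L → n ∉ cn l → n ∉ cn (rebind f l)
  rebind-∉cn f l a i n∉ j with ∈-++⁻ (fnL (rebind f l)) j
  ... | inj₁ k rewrite fnL-rebind f l = n∉ (∈-++⁺ˡ k)
  ... | inj₂ k rewrite bnL-rebind f l = avoids-map {f = f} a i k

  rebindable : Linear P → P ─⟨ l ⟩→ P′ → ∃[ L ] Rebindable P l P′ L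
  rebindable (lin-∙ _ p) (prefix {π} {P}) = fn P , λ f r →
    ren f P ,
    alpha (α-sym (rebind-fix {π = π} f p λ i →
             let j , n∉ = ∈-∖⁻ {xs = fn P} i in r .fixed j n∉))
          prefix ,
    α-refl
  rebindable p (alpha q s) with L , h ← rebindable (proj₁ (linear-α q) p) s = L , λ f r →
    let P″ , s′ , e = h f r in P″ , alpha q s′ , e
  rebindable (lin-∥ _ p q) (par₁ {Q = Q} {l} d s) with L , h ← rebindable p s =
    L ++ fn Q , λ f r →
    let P″ , s′ , e = h f (renames-⊆ ∈-++⁺ˡ r)
    in P″ ∥ Q , par₁ (rebind-disjoint f l λ i → r .fresh i ∘ ∈-++⁺ʳ L) s′ ,
       ∥-cong e (α-sym (ren-fix f q λ i → r .fixed (∈-++⁺ʳ L i) λ j → d (j , i)))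
  rebindable (lin-∥ _ p q) (par₂ {P = P} {l = l} d s) with L , h ← rebindable q s =
    L ++ fn P , λ f r →
    let Q″ , s′ , e = h f (renames-⊆ ∈-++⁺ˡ r)
    in P ∥ Q″ , par₂ (rebind-disjoint f l λ i → r .fresh i ∘ ∈-++⁺ʳ L) s′ ,
       ∥-cong (α-sym (ren-fix f p λ i → r .fixed (∈-++⁺ʳ L i) λ j → d (j , i))) e
  rebindable (lin-∥ _ p q) (syn {P} {P′} {Q} {Q′} {l} {l′} d d₁ d₂ s s′)
    with L , h ← rebindable p s | L′ , h′ ← rebindable q s′ =
    (fn P ++ fn Q) ++ (L ++ L′) , λ f r →
    let ⊆P  = λ {n} (i : n ∈ fn P) → ∈-++⁺ˡ {ys = L ++ L′} (∈-++⁺ˡ {ys = fn Q} i)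
        ⊆Q  = λ {n} (i : n ∈ fn Q) → ∈-++⁺ˡ {ys = L ++ L′} (∈-++⁺ʳ (fn P) i)
        ⊆L  = λ {n} (i : n ∈ L) → ∈-++⁺ʳ (fn P ++ fn Q) (∈-++⁺ˡ {ys = L′} i)
        ⊆L′ = λ {n} (i : n ∈ L′) → ∈-++⁺ʳ (fn P ++ fn Q) (∈-++⁺ʳ L i)
        P″ , t , e = rebindable-single p s h f
          (λ i → r .fresh (∈-++⁺ˡ i) ∘ ⊆L) (λ i → r .fresh (∈-++⁺ˡ i) ∘ ⊆P)
          -- `f` moves the bound names of both actions, but `d₂` keeps those of `l′` out of `fn P`.
          (λ i → let j , n∉ = ∈-∖⁻ {xs = fn P} i in
             r .fixed (⊆P j) ([ n∉ , (λ k → d₂ (k , j)) ]′ ∘ ∈-++⁻ (bnAct l)))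
        Q″ , t′ , e′ = rebindable-single q s′ h′ f
          (λ i → r .fresh (∈-++⁺ʳ (bnAct l) i) ∘ ⊆L′) (λ i → r .fresh (∈-++⁺ʳ (bnAct l) i) ∘ ⊆Q)
          (λ i → let j , n∉ = ∈-∖⁻ {xs = fn Q} i in
             r .fixed (⊆Q j) ([ (λ k → d₁ (k , j)) , n∉ ]′ ∘ ∈-++⁻ (bnAct l)))
    in P″ ∥ Q″ ,
       syn (subst₂ Disjoint (sym (bnAct-rebind f l)) (sym (bnAct-rebind f l′)) (Disjoint-map f d))
           (rebind-disjoint f (act l) λ i → r .fresh (∈-++⁺ˡ i) ∘ ⊆Q)
           (rebind-disjoint f (act l′) λ i → r .fresh (∈-++⁺ʳ (bnAct l) i) ∘ ⊆P) t t′ ,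
       ∥-cong e e′
  rebindable p (pair-comm {l = l} {l′} s) with L , h ← rebindable p s = L , λ f r →
    let P″ , s′ , e = h f record { fixed = λ i n∉ → r .fixed i (n∉ ∘ ∈-++-comm (bnAct l′))
                                 ; fresh = λ i → r .fresh (∈-++-comm (bnAct l) i) }
    in P″ , pair-comm s′ , e
  rebindable (lin-ν x≢y p) (res {x} {y} {P′ = P′} {l = l} x∉ y∉ s) with L , h ← rebindable p s =
    x ∷ y ∷ L , λ f r →
    let P″ , s′ , e = h f (renames-⊆ (there ∘ there) r)
        fx = r .fixed (here refl) (x∉ ∘ ∈-++⁺ʳ (fnL l))
        fy = r .fixed (there (here refl)) (y∉ ∘ ∈-++⁺ʳ (fnL l))
    in ν x y P″ ,
       res (rebind-∉cn f l (r .fresh) (here refl) x∉)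
           (rebind-∉cn f l (r .fresh) (there (here refl)) y∉) s′ ,
       α-trans (ν-cong e) (α-reflexive (cong₂ (λ a b → ν a b (ren f P′)) (sym fx) (sym fy)))
  -- `τ` binds nothing, so `f` fixes all of `L`, here the free names of the target, and the same
  -- transition serves.
  rebindable p (com-unit {P′ = P′} s) = fn P′ , λ f r →
    P′ , com-unit s , α-sym (ren-fix f (linear-step p (com-unit s)) λ i → r .fixed i λ ())
  rebindable p s@(com {x} {y} {x′} {y′} {P′ = P′} t) = fn (ν x y (ν x′ y′ P′)) , λ f r →
    ν x y (ν x′ y′ P′) , s , α-sym (ren-fix f (linear-step p s) λ i → r .fixed i λ ())

  -- Structural congruence

  infix 4 _≈_

  -- `dis` also rewrites below prefixes, hence `≈-∙`. Congruence in the right argument of `∥`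
  -- follows by `≈-comm`.
  data _≈_ : Rel Proc 0ℓ where
    ≈-α       : P =α Q → P ≈ Q
    ≈-sym     : P ≈ Q → Q ≈ P
    ≈-trans   : P ≈ Q → Q ≈ R → P ≈ R
    ≈-∙       : P ≈ Q → π ∙ P ≈ π ∙ Q
    ≈-ν       : P ≈ Q → ν x y P ≈ ν x y Q
    ≈-∥       : P ≈ Q → P ∥ R ≈ Q ∥ R
    ≈-comm    : P ∥ Q ≈ Q ∥ P
    ≈-assoc   : (P ∥ Q) ∥ R ≈ P ∥ Q ∥ R
    ≈-unit    : P ∥ 𝟎 ≈ P
    ≈-extrude : x ∉ fn Q → y ∉ fn Q → ν x y (P ∥ Q) ≈ ν x y P ∥ Q

  ≈-refl : P ≈ P
  ≈-refl = ≈-α α-refl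

  ≈-∥ʳ : P ≈ Q → R ∥ P ≈ R ∥ Q
  ≈-∥ʳ p = ≈-trans ≈-comm (≈-trans (≈-∥ p) ≈-comm)

  fn-extrude : ∀ P Q → x ∉ fn Q → y ∉ fn Q →
               (n ∈ fn (ν x y (P ∥ Q)) → n ∈ fn (ν x y P ∥ Q)) ×
               (n ∈ fn (ν x y P ∥ Q) → n ∈ fn (ν x y (P ∥ Q)))
  fn-extrude {x} {y} {n} P Q x∉ y∉ = to , from
    where
    to : n ∈ fn (ν x y (P ∥ Q)) → n ∈ fn (ν x y P ∥ Q)
    to i with j , n≢x , n≢y ← fn-ν⁻ (P ∥ Q) i with ∈-++⁻ (fn P) j
    ... | inj₁ k = ∈-++⁺ˡ (fn-ν⁺ P k n≢x n≢y)
    ... | inj₂ k = ∈-++⁺ʳ (fn (ν x y P)) k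
    from : n ∈ fn (ν x y P ∥ Q) → n ∈ fn (ν x y (P ∥ Q))
    from i with ∈-++⁻ (fn (ν x y P)) i
    ... | inj₁ j with k , n≢x , n≢y ← fn-ν⁻ P j = fn-ν⁺ (P ∥ Q) (∈-++⁺ˡ k) n≢x n≢y
    ... | inj₂ j = fn-ν⁺ (P ∥ Q) (∈-++⁺ʳ (fn P) j) (≢-of j x∉) (≢-of j y∉)

  ∈-++-assoc : ∀ xs ys zs → (n ∈ (xs ++ ys) ++ zs → n ∈ xs ++ ys ++ zs) ×
                            (n ∈ xs ++ ys ++ zs → n ∈ (xs ++ ys) ++ zs)
  ∈-++-assoc xs ys zs = subst (_ ∈_) (++-assoc xs ys zs) , subst (_ ∈_) (sym (++-assoc xs ys zs))

  fn-≈ : P ≈ Q → (n ∈ fn P → n ∈ fn Q) × (n ∈ fn Q → n ∈ fn P)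
  fn-≈ (≈-α p) = fn-α p
  fn-≈ (≈-sym p) with h , k ← fn-≈ p = k , h
  fn-≈ (≈-trans p q) with h , k ← fn-≈ p | h′ , k′ ← fn-≈ q = h′ ∘ h , k ∘ k′
  fn-≈ (≈-∙ {P} {Q} {π} p) with h , k ← fn-≈ p =
    fn-∙ π π P Q refl (fn-∖ {P = P} {Q} h) , fn-∙ π π Q P refl (fn-∖ {P = Q} {P} k)
  fn-≈ (≈-ν {P} {Q} p) with h , k ← fn-≈ p = fn-∖ {P = P} {Q} h , fn-∖ {P = Q} {P} k
  fn-≈ (≈-∥ {P} {Q} {R} p) with h , k ← fn-≈ p =
    fn-∥ {P = P} {Q} {R} {R} h id , fn-∥ {P = Q} {P} {R} {R} k id
  fn-≈ (≈-comm {P} {Q}) = ∈-++-comm (fn P) , ∈-++-comm (fn Q)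
  fn-≈ (≈-assoc {P} {Q} {R}) = ∈-++-assoc (fn P) (fn Q) (fn R)
  fn-≈ (≈-unit {P}) = (λ i → [ id , (λ ()) ]′ (∈-++⁻ (fn P) i)) , ∈-++⁺ˡ
  fn-≈ (≈-extrude {Q = Q} {P = P} x∉ y∉) = fn-extrude P Q x∉ y∉

  ren-≈ : ∀ f → P ≈ Q → ren f P ≈ ren f Q
  ren-≈ f (≈-α p)       = ≈-α (ren-α f p)
  ren-≈ f (≈-sym p)     = ≈-sym (ren-≈ f p)
  ren-≈ f (≈-trans p q) = ≈-trans (ren-≈ f p) (ren-≈ f q)
  ren-≈ f (≈-∙ p)       = ≈-∙ (ren-≈ f p)
  ren-≈ f (≈-ν p)       = ≈-ν (ren-≈ f p)
  ren-≈ f (≈-∥ p)       = ≈-∥ (ren-≈ f p)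
  ren-≈ f ≈-comm        = ≈-comm
  ren-≈ f ≈-assoc       = ≈-assoc
  ren-≈ f ≈-unit        = ≈-unit
  ren-≈ f (≈-extrude {Q = Q} x∉ y∉) = ≈-extrude (∉-ren f Q x∉) (∉-ren f Q y∉)

  linear-≈ : P ≈ Q → (Linear P → Linear Q) × (Linear Q → Linear P)
  linear-≈ (≈-α p) = linear-α p
  linear-≈ (≈-sym p) with h , k ← linear-≈ p = k , h
  linear-≈ (≈-trans p q) with h , k ← linear-≈ p | h′ , k′ ← linear-≈ q = h′ ∘ h , k ∘ k′
  linear-≈ (≈-∙ p) with h , k ← linear-≈ p =
    (λ { (lin-∙ d l) → lin-∙ (λ (i , j) → d (i , proj₂ (fn-≈ p) j)) (h l) }) ,
    (λ { (lin-∙ d l) → lin-∙ (λ (i , j) → d (i , proj₁ (fn-≈ p) j)) (k l) })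
  linear-≈ (≈-ν p) with h , k ← linear-≈ p =
    (λ { (lin-ν x≢y l) → lin-ν x≢y (h l) }) , (λ { (lin-ν x≢y l) → lin-ν x≢y (k l) })
  linear-≈ (≈-∥ p) with h , k ← linear-≈ p =
    (λ { (lin-∥ d l m) → lin-∥ (λ (i , j) → d (proj₂ (fn-≈ p) i , j)) (h l) m }) ,
    (λ { (lin-∥ d l m) → lin-∥ (λ (i , j) → d (proj₁ (fn-≈ p) i , j)) (k l) m })
  linear-≈ ≈-comm =
    (λ { (lin-∥ d l m) → lin-∥ (λ (i , j) → d (j , i)) m l }) ,
    (λ { (lin-∥ d l m) → lin-∥ (λ (i , j) → d (j , i)) m l })
  linear-≈ (≈-assoc {P} {Q} {R}) = to , from
    where
    to : Linear ((P ∥ Q) ∥ R) → Linear (P ∥ Q ∥ R)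
    to (lin-∥ d (lin-∥ d′ p q) r) =
      lin-∥ (λ (i , j) → [ (λ k → d′ (i , k)) , (λ k → d (∈-++⁺ˡ i , k)) ]′ (∈-++⁻ (fn Q) j)) p
            (lin-∥ (λ (i , j) → d (∈-++⁺ʳ (fn P) i , j)) q r)
    from : Linear (P ∥ Q ∥ R) → Linear ((P ∥ Q) ∥ R)
    from (lin-∥ d p (lin-∥ d′ q r)) =
      lin-∥ (λ (i , j) → [ (λ k → d (k , ∈-++⁺ʳ (fn Q) j)) , (λ k → d′ (k , j)) ]′ (∈-++⁻ (fn P) i))
            (lin-∥ (λ (i , j) → d (i , ∈-++⁺ˡ j)) p q) r
  linear-≈ ≈-unit = (λ { (lin-∥ _ l _) → l }) , (λ l → lin-∥ (λ ()) l lin-𝟎)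
  linear-≈ (≈-extrude {Q = Q} {P = P} x∉ y∉) =
    (λ { (lin-ν x≢y (lin-∥ d p q)) →
           lin-∥ (λ (i , j) → d (proj₁ (fn-ν⁻ P i) , j)) (lin-ν x≢y p) q }) ,
    (λ { (lin-∥ d (lin-ν x≢y p) q) →
           lin-ν x≢y (lin-∥ (λ (i , j) → d (fn-ν⁺ P i (≢-of j x∉) (≢-of j y∉) , j)) p q) })

  disjoint-≈ : P ≈ Q → Disjoint xs (fn P) → Disjoint xs (fn Q)
  disjoint-≈ p d (i , j) = d (i , proj₂ (fn-≈ p) j)

  -- Simulation up to structural congruence

  Matches : Proc → Label → Proc → Set
  Matches Q l S = ∃[ S′ ] (Q ─⟨ l ⟩→ S′) × S ≈ S′

  Sim : Rel Proc 0ℓ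
  Sim P Q = ∀ {l S} → P ─⟨ l ⟩→ S → Matches Q l S

  matches-α : Q =α R → Matches R l S → Matches Q l S
  matches-α p (S′ , s , e) = S′ , alpha p s , e

  matches-≈ : S ≈ T → Matches Q l T → Matches Q l S
  matches-≈ p (S′ , s , e) = S′ , s , ≈-trans p e

  sim-α : P =α Q → Sim P Q
  sim-α p s = _ , alpha (α-sym p) s , ≈-refl

  sim-trans : Sim P Q → Sim Q R → Sim P R
  sim-trans h k s with _ , s′ , e ← h s = matches-≈ e (k s′)

  -- The transition is pulled back along `f ⁻¹`, matched there, and pushed forward. In `sim-ν` this
  -- carries the hypothesis on the bodies over to freshly renamed binders.
  sim-ren : ∀ f → Sim P Q → Sim (ren f P) (ren f Q)
  sim-ren {P} {Q} f h {l} {S} s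
    with s₀ ← ren-step (f ⁻¹) s rewrite ren-⁻¹ f P
    with S′ , s′ , e ← h s₀ with s″ ← ren-step f s′ rewrite renLabel-⁻¹ʳ f l =
    ren f S′ , s″ , ≈-trans (≈-α (α-reflexive (sym (ren-⁻¹ʳ f S)))) (ren-≈ f e)

  -- Since `≈` preserves free names, the bijection found for the continuation `P` fixes the right
  -- names of `Q` as well, and the same change of bound name applies to both.
  sim-∙ : P ≈ Q → Linear Q → Sim (π ∙ P) (π ∙ Q)
  sim-∙ {P} {Q} {π} p q s with π′ , refl , a ← ∙-inv s with α⇒head a
  ... | head-∙ f refl fix e =
    ren f Q ,
    alpha (α-sym (rebind-fix {π = π} f q
             λ i → fix (fn-∖ {P = Q} {P} (proj₂ (fn-≈ p)) i)))
          prefix ,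
    ≈-trans (≈-α (α-sym e)) (ren-≈ f p)

  sim-∥ : P ≈ Q → Sim P Q → Sim (P ∥ R) (Q ∥ R)
  sim-∥ p h s with ∥-inv s
  ... | left d t e with _ , t′ , a ← h t =
    _ , par₁ d t′ , ≈-trans (≈-α (α-sym e)) (≈-∥ a)
  ... | right d t e =
    _ , par₂ (disjoint-≈ p d) t , ≈-trans (≈-α (α-sym e)) (≈-∥ p)
  ... | both d d₁ d₂ t u e o with _ , t′ , a ← h t =
    _ , syn-either d d₁ (disjoint-≈ p d₂) t′ u o , ≈-trans (≈-α (α-sym e)) (≈-∥ a)

  sim-comm : Sim (P ∥ Q) (Q ∥ P)
  sim-comm s with ∥-inv s
  ... | left d t e  = _ , par₂ d t , ≈-trans (≈-α (α-sym e)) ≈-comm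
  ... | right d t e = _ , par₁ d t , ≈-trans (≈-α (α-sym e)) ≈-comm
  ... | both d d₁ d₂ t u e o =
    _ , syn-either (λ (i , j) → d (j , i)) d₂ d₁ u t ([ inj₂ , inj₁ ]′ o) ,
    ≈-trans (≈-α (α-sym e)) ≈-comm

  sim-unit : Sim (P ∥ 𝟎) P
  sim-unit s with ∥-inv s
  ... | left d t e = _ , t , ≈-trans (≈-α (α-sym e)) ≈-unit
  ... | right d t e = contradiction t 𝟎-inv
  ... | both _ _ _ _ u _ _ = contradiction u 𝟎-inv

  sim-unit⁻ : Sim P (P ∥ 𝟎)
  sim-unit⁻ s = _ , par₁ (λ ()) s , ≈-sym ≈-unit

  IsPair : Label → Act → Act → Set
  IsPair l π π′ = l ≡ pair π π′ ⊎ l ≡ pair π′ π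

  pair-bnˡ : IsPair l π π′ → n ∈ bnAct π → n ∈ bnL l
  pair-bnˡ (inj₁ refl) i = ∈-++⁺ˡ i
  pair-bnˡ {π′ = π′} (inj₂ refl) i = ∈-++⁺ʳ (bnAct π′) i

  pair-bnʳ : IsPair l π π′ → n ∈ bnAct π′ → n ∈ bnL l
  pair-bnʳ {π = π} (inj₁ refl) i = ∈-++⁺ʳ (bnAct π) i
  pair-bnʳ (inj₂ refl) i = ∈-++⁺ˡ i

  disjoint-++ : Disjoint xs ys → Disjoint xs L → Disjoint xs (ys ++ L)
  disjoint-++ {ys = ys} d d′ (i , j) = [ (λ k → d (i , k)) , (λ k → d′ (i , k)) ]′ (∈-++⁻ ys j)

  pair-disjoint-bn : IsPair l π π′ → Disjoint (bnAct π) xs → Disjoint (bnAct π′) xs →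
                     Disjoint (bnL l) xs
  pair-disjoint-bn {π = π} (inj₁ refl) d d′ (i , j) =
    [ (λ k → d (k , j)) , (λ k → d′ (k , j)) ]′ (∈-++⁻ (bnAct π) i)
  pair-disjoint-bn {π′ = π′} (inj₂ refl) d d′ (i , j) =
    [ (λ k → d′ (k , j)) , (λ k → d (k , j)) ]′ (∈-++⁻ (bnAct π′) i)

  sim-assoc : Sim ((P ∥ Q) ∥ R) (P ∥ Q ∥ R)
  sim-assoc {P} {Q} {R} s with ∥-inv s
  ... | right d t e =
    _ , par₂ (λ (i , j) → d (i , ∈-++⁺ˡ j)) (par₂ (λ (i , j) → d (i , ∈-++⁺ʳ (fn P) j)) t) ,
    ≈-trans (≈-α (α-sym e)) ≈-assoc
  ... | left d t e with ∥-inv t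
  ...   | left d′ u e′ =
    _ , par₁ (disjoint-++ d′ d) u ,
    ≈-trans (≈-α (α-sym e)) (≈-trans (≈-∥ (≈-α (α-sym e′))) ≈-assoc)
  ...   | right d′ u e′ =
    _ , par₂ d′ (par₁ d u) ,
    ≈-trans (≈-α (α-sym e)) (≈-trans (≈-∥ (≈-α (α-sym e′))) ≈-assoc)
  ...   | both d₀ d₁ d₂ u v e′ o =
    _ , syn-either d₀ (disjoint-++ d₁ (λ (i , j) → d (pair-bnˡ o i , j))) d₂ u
          (par₁ (λ (i , j) → d (pair-bnʳ o i , j)) v) o ,
    ≈-trans (≈-α (α-sym e)) (≈-trans (≈-∥ (≈-α (α-sym e′))) ≈-assoc)
  sim-assoc {P} {Q} {R} s | both d d₁ d₂ t u e o with ∥-inv t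
  ...   | left d′ v e′ =
    _ , syn-either d (disjoint-++ d′ d₁) (λ (i , j) → d₂ (i , ∈-++⁺ˡ j)) v
          (par₂ (λ (i , j) → d₂ (i , ∈-++⁺ʳ (fn P) j)) u) o ,
    ≈-trans (≈-α (α-sym e)) (≈-trans (≈-∥ (≈-α (α-sym e′))) ≈-assoc)
  ...   | right d′ v e′ =
    _ , par₂ (pair-disjoint-bn o d′ (λ (i , j) → d₂ (i , ∈-++⁺ˡ j)))
          (syn-either d d₁ (λ (i , j) → d₂ (i , ∈-++⁺ʳ (fn P) j)) v u o) ,
    ≈-trans (≈-α (α-sym e)) (≈-trans (≈-∥ (≈-α (α-sym e′))) ≈-assoc)
  -- Three components never synchronise: an `act` label would have to be a pair.
  ...   | both _ _ _ _ _ _ (inj₁ ())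
  ...   | both _ _ _ _ _ _ (inj₂ ())

  -- `sim-comm` followed by `sim-assoc` rotates the three components; two rotations and a final
  -- exchange give the converse.
  sim-assoc⁻ : Sim (P ∥ Q ∥ R) ((P ∥ Q) ∥ R)
  sim-assoc⁻ = sim-trans sim-comm (sim-trans sim-assoc (sim-trans sim-comm (sim-trans sim-assoc sim-comm)))

  -- By α-conversion, the binders x and y may be assumed not to occur in the label.
  sim-fresh : P ≈ Q → Linear P → x ≢ y → x ∉ fn P → y ∉ fn P → P ─⟨ l ⟩→ S →
              (∀ f → f · x ∉ cn l → f · y ∉ cn l → ren f P ─⟨ l ⟩→ S → Matches (ren f Q) l S) →
              Matches Q l S
  sim-fresh {P} {Q} {l = l} p lin x≢y x∉ y∉ s h
    with f , fx , fy , fix ← freshen x≢y (cn l ++ fn P) =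
    matches-α (α-sym (ren-fix f (proj₁ (linear-≈ p) lin) (fix′ ∘ proj₂ (fn-≈ p))))
      (h f (∉-++⁻ˡ fx) (∉-++⁻ˡ fy) (alpha (ren-fix f lin fix′) s))
    where
    fix′ : f fixes fn P
    fix′ i = fix (∈-∖⁺ (∈-++⁺ʳ (cn l) i)
      λ { (here refl) → x∉ i ; (there (here refl)) → y∉ i })

  nu-sim : Sim P Q → NuStep x y P l S → Matches (ν x y Q) l S
  nu-sim h (nu-res x∉ y∉ s) with _ , s′ , e ← h s = _ , res x∉ y∉ s′ , ≈-ν e
  nu-sim h (nu-unit s)      with _ , s′ , e ← h s = _ , com-unit s′ , e
  nu-sim h (nu-com s)       with _ , s′ , e ← h s = _ , com s′ , ≈-ν (≈-ν e)

  ν-fresh : Linear (ν x y P) → Sim P Q → x ∉ cn l → y ∉ cn l → ν x y P ─⟨ l ⟩→ S →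
            Matches (ν x y Q) l S
  ν-fresh lin h x∉l y∉l s with ν-inv-fresh lin x∉l y∉l s
  ... | inj₁ (_ , t , e) = matches-≈ (≈-α (α-sym e)) (nu-sim h t)
  ... | inj₂ (_ , t , e) = matches-≈ (≈-α (α-sym e)) (matches-α ν-comm (nu-sim h t))

  sim-ν : P ≈ Q → Linear (ν x y P) → Sim P Q → Sim (ν x y P) (ν x y Q)
  sim-ν {P} p lin@(lin-ν x≢y _) h s =
    sim-fresh (≈-ν p) lin x≢y (fst∉fn-ν P) (snd∉fn-ν P) s
      λ f → ν-fresh (ren-linear f lin) (sim-ren f h)

  -- Scope extrusion and its converse

  pair-cn⁻ : IsPair l π π′ → n ∉ cn l → n ∉ fnAct π ++ bnAct π × n ∉ fnAct π′ ++ bnAct π′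
  pair-cn⁻ {π = π} {π′} (inj₁ refl) n∉ = n∉ ∘ pair-cnˡ π π′ , n∉ ∘ pair-cnʳ π π′
  pair-cn⁻ {π = π} {π′} (inj₂ refl) n∉ = n∉ ∘ pair-cnʳ π′ π , n∉ ∘ pair-cnˡ π′ π

  ∉-step : Linear P → P ─⟨ l ⟩→ P′ → n ∉ fn P → n ∉ cn l → n ∉ fn P′
  ∉-step {l = l} p s n∉ n∉l i = [ n∉ , n∉l ∘ ∈-++⁺ʳ (fnL l) ]′ (fn-step p s i)

  -- Having neither `x` nor `y` free, `Q` takes no part in a synchronisation on them. If `Q` moves
  -- under `nu-res`, they stay absent from its target because the label does not contain them, so
  -- extrusion applies again to the targets.
  nu-extrude : Linear Q → x ∉ fn Q → y ∉ fn Q → NuStep x y (P ∥ Q) l S →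
               Matches (ν x y P ∥ Q) l S
  nu-extrude {P = P} q x∉ y∉ (nu-res x∉l y∉l s) with ∥-inv s
  ... | left d t e =
    _ , par₁ d (res x∉l y∉l t) , ≈-trans (≈-α (ν-cong (α-sym e))) (≈-extrude x∉ y∉)
  ... | right d t e =
    _ , par₂ (λ (i , j) → d (i , proj₁ (fn-ν⁻ P j))) t ,
    ≈-trans (≈-α (ν-cong (α-sym e))) (≈-extrude (∉-step q t x∉ x∉l) (∉-step q t y∉ y∉l))
  ... | both d d₁ d₂ t u e o
    with x∉π , x∉π′ ← pair-cn⁻ o x∉l | y∉π , y∉π′ ← pair-cn⁻ o y∉l =
    _ , syn-either d d₁ (λ (i , j) → d₂ (i , proj₁ (fn-ν⁻ P j))) (res x∉π y∉π t) u o ,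
    ≈-trans (≈-α (ν-cong (α-sym e))) (≈-extrude (∉-step q u x∉ x∉π′) (∉-step q u y∉ y∉π′))
  nu-extrude q x∉ y∉ (nu-unit s) with ∥-inv s
  ... | left d t e = _ , par₁ (λ ()) (com-unit t) , ≈-α (α-sym e)
  ... | right d t e = contradiction (fnL⊆fn t (here refl)) x∉
  ... | both _ _ _ _ u _ (inj₁ refl) = contradiction (fnL⊆fn u (here refl)) y∉
  ... | both _ _ _ _ u _ (inj₂ refl) = contradiction (fnL⊆fn u (here refl)) x∉
  nu-extrude q x∉ y∉ (nu-com s) with ∥-inv s
  ... | left d t e =
    _ , par₁ (λ ()) (com t) ,
    -- `d` keeps the names bound in the label out of `fn Q`, so the inner restriction can be
    -- extruded before the outer one.
    ≈-trans (≈-α (ν-cong (ν-cong (α-sym e))))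
    (≈-trans (≈-ν (≈-extrude (λ i → d (here refl , i)) (λ i → d (there (here refl) , i))))
             (≈-extrude x∉ y∉))
  ... | right d t e = contradiction (fnL⊆fn t (here refl)) x∉
  ... | both _ _ _ _ u _ (inj₁ refl) = contradiction (fnL⊆fn u (here refl)) y∉
  ... | both _ _ _ _ u _ (inj₂ refl) = contradiction (fnL⊆fn u (here refl)) x∉

  extrude-fresh : Linear (ν x y (P ∥ Q)) → x ∉ fn Q → y ∉ fn Q → x ∉ cn l → y ∉ cn l →
                  ν x y (P ∥ Q) ─⟨ l ⟩→ S → Matches (ν x y P ∥ Q) l S
  extrude-fresh lin@(lin-ν _ (lin-∥ _ _ q)) x∉ y∉ x∉l y∉l s with ν-inv-fresh lin x∉l y∉l s
  ... | inj₁ (_ , t , e) = matches-≈ (≈-α (α-sym e)) (nu-extrude q x∉ y∉ t)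
  ... | inj₂ (_ , t , e) =
    matches-≈ (≈-α (α-sym e)) (matches-α (∥-cong ν-comm α-refl) (nu-extrude q y∉ x∉ t))

  sim-extrude : Linear (ν x y (P ∥ Q)) → x ∉ fn Q → y ∉ fn Q →
                Sim (ν x y (P ∥ Q)) (ν x y P ∥ Q)
  sim-extrude {P = P} {Q} lin@(lin-ν x≢y _) x∉ y∉ s =
    sim-fresh (≈-extrude x∉ y∉) lin x≢y (fst∉fn-ν (P ∥ Q)) (snd∉fn-ν (P ∥ Q)) s
      λ f → extrude-fresh (ren-linear f lin) (∉-ren f Q x∉) (∉-ren f Q y∉)

  -- The label `τ` hides `z` and `w`, so no side condition of the given transition keeps them out of
  -- `Q`, whereas `par₁` inside the scope demands it.
  nu-intrude-com : Linear P → x ∉ fn Q → y ∉ fn Q → P ─⟨ pair (send x z) (recv y w) ⟩→ P′ →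
                   Matches (ν x y (P ∥ Q)) τ (ν x y (ν z w P′) ∥ Q)
  nu-intrude-com {P} {x} {Q} {y} {z} {w} {P′} p x∉ y∉ s
    with L , h ← rebindable p s
    -- Avoiding `L` lets the transition be repeated, and avoiding `fn Q` permits `par₁` and the
    -- extrusion. With `fn P′` in the list, `f` fixes the free names of `ν z w P′`.
    with f , fz , fw , fix ← freshen (com-≢ s) (L ++ fn Q ++ fn P′)
    with P″ , s′ , e ← h f record
      { fixed = λ i n∉ → fix (∈-∖⁺ (∈-++⁺ˡ i) n∉)
      ; fresh = λ { (here refl) → ∉-++⁻ˡ fz ; (there (here refl)) → ∉-++⁻ˡ fw } } =
    ν x y (ν (f · z) (f · w) (P″ ∥ Q)) ,
    com (par₁ (λ { (here refl , i) → fz∉ i ; (there (here refl) , i) → fw∉ i }) s′) ,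
    ≈-trans (≈-sym (≈-extrude x∉ y∉))
    (≈-ν (≈-trans (≈-∥ (≈-α ν≡)) (≈-sym (≈-extrude fz∉ fw∉))))
    where
    fz∉ : f · z ∉ fn Q
    fz∉ = ∉-++⁻ˡ (∉-++⁻ʳ L fz)
    fw∉ : f · w ∉ fn Q
    fw∉ = ∉-++⁻ˡ (∉-++⁻ʳ L fw)
    ν≡ : ν z w P′ =α ν (f · z) (f · w) P″
    ν≡ = α-trans
      (α-sym (ren-fix f (lin-ν (com-≢ s) (linear-step p s)) λ i →
        let j , n∉ = ∈-∖⁻ {xs = fn P′} i in fix (∈-∖⁺ (∈-++⁺ʳ L (∈-++⁺ʳ (fn Q) j)) n∉)))
      (ν-cong (α-sym e))

  nu-intrude : Linear P → x ∉ fn Q → y ∉ fn Q → Disjoint (bnL l) (fn Q) → NuStep x y P l S →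
               Matches (ν x y (P ∥ Q)) l (S ∥ Q)
  nu-intrude p x∉ y∉ d (nu-res x∉l y∉l s) =
    _ , res x∉l y∉l (par₁ d s) , ≈-sym (≈-extrude x∉ y∉)
  nu-intrude p x∉ y∉ d (nu-unit s) = _ , com-unit (par₁ (λ ()) s) , ≈-refl
  nu-intrude p x∉ y∉ d (nu-com s)  = nu-intrude-com p x∉ y∉ s

  nu-intrude-syn : Linear Q → x ∉ fn Q → y ∉ fn Q → x ∉ cn l → y ∉ cn l →
                   Disjoint (bnAct π) (bnAct π′) → Disjoint (bnAct π) (fn Q) →
                   Disjoint (bnAct π′) (fn P) → NuStep x y P (act π) S →
                   Q ─⟨ act π′ ⟩→ Q′ → IsPair l π π′ → Matches (ν x y (P ∥ Q)) l (S ∥ Q′)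
  -- An `act` label leaves only `nu-res`, as the other constructors of `NuStep` have label `τ`.
  nu-intrude-syn q x∉ y∉ x∉l y∉l d d₁ d₂ (nu-res _ _ s) u o =
    _ , res x∉l y∉l (syn-either d d₁ d₂ s u o) ,
    ≈-sym (≈-extrude (∉-step q u x∉ (proj₂ (pair-cn⁻ o x∉l)))
                     (∉-step q u y∉ (proj₂ (pair-cn⁻ o y∉l))))

  disjoint-ν⁻ : ∀ P → Disjoint xs (fn (ν x y P)) → x ∉ xs → y ∉ xs → Disjoint xs (fn P)
  disjoint-ν⁻ P d x∉ y∉ (i , j) = d (i , fn-ν⁺ P j (≢-of i x∉) (≢-of i y∉))

  intrude-fresh : Linear (ν x y P ∥ Q) → x ∉ fn Q → y ∉ fn Q → x ∉ cn l → y ∉ cn l →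
                  ν x y P ∥ Q ─⟨ l ⟩→ S → Matches (ν x y (P ∥ Q)) l S
  intrude-fresh {P = P} {l = l} (lin-∥ _ lin@(lin-ν _ p) q) x∉ y∉ x∉l y∉l s with ∥-inv s
  ... | left d t e with ν-inv-fresh lin x∉l y∉l t
  ...   | inj₁ (_ , u , e′) =
    matches-≈ (≈-α (α-sym (α-trans (∥-cong e′ α-refl) e))) (nu-intrude p x∉ y∉ d u)
  ...   | inj₂ (_ , u , e′) =
    matches-≈ (≈-α (α-sym (α-trans (∥-cong e′ α-refl) e)))
      (matches-α ν-comm (nu-intrude p y∉ x∉ d u))
  intrude-fresh {P = P} {l = l} (lin-∥ _ lin@(lin-ν _ p) q) x∉ y∉ x∉l y∉l s | right d t e =
    _ , res x∉l y∉l (par₂ (disjoint-ν⁻ P d (∉-++⁻ʳ (fnL l) x∉l) (∉-++⁻ʳ (fnL l) y∉l)) t) ,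
    ≈-trans (≈-α (α-sym e)) (≈-sym (≈-extrude (∉-step q t x∉ x∉l) (∉-step q t y∉ y∉l)))
  intrude-fresh {P = P} {l = l} (lin-∥ _ lin@(lin-ν _ p) q) x∉ y∉ x∉l y∉l s
    | both {π} {π′} d d₁ d₂ t u e o
    with x∉π , x∉π′ ← pair-cn⁻ o x∉l | y∉π , y∉π′ ← pair-cn⁻ o y∉l
    with d₂′ ← disjoint-ν⁻ P d₂ (∉-++⁻ʳ (fnAct π′) x∉π′) (∉-++⁻ʳ (fnAct π′) y∉π′)
    with ν-inv-fresh lin x∉π y∉π t
  ... | inj₁ (_ , v , e′) =
    matches-≈ (≈-α (α-sym (α-trans (∥-cong e′ α-refl) e)))
      (nu-intrude-syn q x∉ y∉ x∉l y∉l d d₁ d₂′ v u o)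
  ... | inj₂ (_ , v , e′) =
    matches-≈ (≈-α (α-sym (α-trans (∥-cong e′ α-refl) e)))
      (matches-α ν-comm (nu-intrude-syn q y∉ x∉ y∉l x∉l d d₁ d₂′ v u o))

  sim-intrude : Linear (ν x y P ∥ Q) → x ∉ fn Q → y ∉ fn Q →
                Sim (ν x y P ∥ Q) (ν x y (P ∥ Q))
  sim-intrude {x} {y} {P} {Q} lin@(lin-∥ _ (lin-ν x≢y _) _) x∉ y∉ s =
    sim-fresh (≈-sym (≈-extrude x∉ y∉)) lin x≢y (∉-∥ (fst∉fn-ν P) x∉) (∉-∥ (snd∉fn-ν P) y∉) s
      λ f → intrude-fresh (ren-linear f lin) (∉-ren f Q x∉) (∉-ren f Q y∉)
    where
    ∉-∥ : ∀ {n} → n ∉ fn (ν x y P) → n ∉ fn Q → n ∉ fn (ν x y P ∥ Q)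
    ∉-∥ a b = [ a , b ]′ ∘ ∈-++⁻ (fn (ν x y P))

  -- From structural congruence to bisimilarity

  -- The two directions are proved at once because `≈-sym` exchanges them; `linear-≈` makes the
  -- middle process of `≈-trans` linear.
  ≈⇒sim : P ≈ Q → Linear P → Linear Q → Sim P Q × Sim Q P
  ≈⇒sim (≈-α p) _ _ = sim-α p , sim-α (α-sym p)
  ≈⇒sim (≈-sym p) lp lq with h , k ← ≈⇒sim p lq lp = k , h
  ≈⇒sim (≈-trans p q) lp lr with lq ← proj₁ (linear-≈ p) lp
    with h , k ← ≈⇒sim p lp lq | h′ , k′ ← ≈⇒sim q lq lr = sim-trans h h′ , sim-trans k′ k
  ≈⇒sim (≈-∙ p) (lin-∙ _ lp) (lin-∙ _ lq) = sim-∙ p lq , sim-∙ (≈-sym p) lp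
  ≈⇒sim (≈-ν p) lp@(lin-ν _ lp′) lq@(lin-ν _ lq′) with h , k ← ≈⇒sim p lp′ lq′ =
    sim-ν p lp h , sim-ν (≈-sym p) lq k
  ≈⇒sim (≈-∥ p) (lin-∥ _ lp _) (lin-∥ _ lq _) with h , k ← ≈⇒sim p lp lq =
    sim-∥ p h , sim-∥ (≈-sym p) k
  ≈⇒sim ≈-comm _ _ = sim-comm , sim-comm
  ≈⇒sim ≈-assoc _ _ = sim-assoc , sim-assoc⁻
  ≈⇒sim ≈-unit _ _ = sim-unit , sim-unit⁻
  ≈⇒sim (≈-extrude x∉ y∉) lp lq = sim-extrude lp x∉ y∉ , sim-intrude lq x∉ y∉

  linear-≈⇒∼ : Linear P → P ≈ Q → P ∼ Q
  linear-≈⇒∼ {P} {Q} lp p = (λ P Q → Linear P × P ≈ Q) , bisimulation , lp , p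
    where
    bisimulation : IsBisimulation (λ P Q → Linear P × P ≈ Q)
    bisimulation .IsBisimulation.forth (l , p) s
      with Q′ , s′ , e ← proj₁ (≈⇒sim p l (proj₁ (linear-≈ p) l)) s =
      Q′ , s′ , linear-step l s , e
    bisimulation .IsBisimulation.back (l , p) s
      with P′ , s′ , e ← proj₂ (≈⇒sim p l (proj₁ (linear-≈ p) l)) s =
      P′ , s′ , linear-step l s′ , ≈-sym e

  -- Disentanglement

  ∏-∷ : ∀ P Ps → ∏ (P ∷ Ps) ≈ P ∥ ∏ Ps
  ∏-∷ P []       = ≈-sym ≈-unit
  ∏-∷ P (Q ∷ Ps) = ≈-refl

  ∏-++ : ∀ Ps Qs → ∏ (Ps ++ Qs) ≈ ∏ Ps ∥ ∏ Qs
  ∏-++ []       Qs = ≈-trans (≈-sym ≈-unit) ≈-comm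
  ∏-++ (P ∷ Ps) Qs =
    ≈-trans (∏-∷ P (Ps ++ Qs)) (≈-trans (≈-∥ʳ (∏-++ Ps Qs))
    (≈-trans (≈-sym ≈-assoc) (≈-∥ (≈-sym (∏-∷ P Ps)))))

  ∏-partition : ∀ x y Ps → let ins , outs = partition (mentions? x y) Ps in
                ∏ Ps ≈ ∏ ins ∥ ∏ outs
  ∏-partition x y [] = ≈-sym ≈-unit
  ∏-partition x y (P ∷ Ps)
    with does (mentions? x y P) | partition (mentions? x y) Ps | ∏-partition x y Ps
  ... | true | ins , outs | h =
    ≈-trans (∏-∷ P Ps) (≈-trans (≈-∥ʳ h) (≈-trans (≈-sym ≈-assoc) (≈-∥ (≈-sym (∏-∷ P ins)))))
  ... | false | ins , outs | h =
    ≈-trans (∏-∷ P Ps) (≈-trans (≈-∥ʳ h) (≈-trans (≈-sym ≈-assoc)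
    (≈-trans (≈-∥ ≈-comm) (≈-trans ≈-assoc (≈-∥ʳ (≈-sym (∏-∷ P outs)))))))

  ∉-∏ : ∀ {Ps} → All (λ P → n ∉ fn P) Ps → n ∉ fn (∏ Ps)
  ∉-∏ {Ps = P ∷ []}     (p ∷ []) i = p i
  ∉-∏ {Ps = P ∷ Q ∷ Ps} (p ∷ ps) i = [ p , ∉-∏ ps ]′ (∈-++⁻ (fn P) i)

  -- The components that `partition` leaves outside have neither `x` nor `y` free, which is the side
  -- condition of `≈-extrude`.
  ≈-dis : ∀ P → P ≈ dis P
  ≈-dis (π ∙ P) = ≈-∙ (≈-dis P)
  ≈-dis 𝟎       = ≈-refl
  ≈-dis (P ∥ Q) =
    ≈-trans (≈-∥ (≈-dis P)) (≈-trans (≈-∥ʳ (≈-dis Q))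
    (≈-sym (∏-++ (disComponents P) (disComponents Q))))
  ≈-dis (ν x y P) =
    ≈-trans (≈-ν (≈-trans (≈-dis P) (∏-partition x y (disComponents P))))
    (≈-trans (≈-extrude (∉-∏ (All.map (_∘ inj₁) outside)) (∉-∏ (All.map (_∘ inj₂) outside)))
    (≈-sym (∏-∷ _ (proj₂ (partition (mentions? x y) (disComponents P))))))
    where
    outside = proj₂ (partition-All (mentions? x y) (disComponents P))

  -- Typing

  names : HyperEnv → List Name
  names = concatMap (map proj₁)

  names-≋ : ∀ {𝒢 ℋ} → 𝒢 ≋ ℋ → names 𝒢 ↭ names ℋ
  names-≋ (Homogeneous.refl [])         = ↭-refl
  names-≋ (Homogeneous.refl (p ∷ ps))   = ++⁺ (map⁺ proj₁ p) (names-≋ (Homogeneous.refl ps))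
  names-≋ (Homogeneous.prep p ps)       = ++⁺ (map⁺ proj₁ p) (names-≋ ps)
  names-≋ (Homogeneous.swap {x = Γ} {Δ} p q ps) =
    ↭-trans (shifts (map proj₁ Γ) (map proj₁ Δ))
      (++⁺ (map⁺ proj₁ q) (++⁺ (map⁺ proj₁ p) (names-≋ ps)))
  names-≋ (Homogeneous.trans p q)       = ↭-trans (names-≋ p) (names-≋ q)

  -- Serves `cut`, where both names at the front are dropped, and `tens`, where `𝒢` is empty and
  -- only the first is dropped.
  names-join : ∀ Γ Δ 𝒢 → x ∷ map proj₁ Γ ++ y ∷ map proj₁ Δ ++ names 𝒢 ↭
                         x ∷ y ∷ names ((Γ ++ Δ) ∷ 𝒢)
  names-join {x} {y} Γ Δ 𝒢 = prep x (↭-trans (shift y (map proj₁ Γ) (map proj₁ Δ ++ names 𝒢))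
    (prep y (↭-reflexive (trans (sym (++-assoc (map proj₁ Γ) (map proj₁ Δ) (names 𝒢)))
      (cong (_++ names 𝒢) (sym (map-++ proj₁ Γ Δ)))))))

  Unique-resp-↭ : xs ↭ ys → Unique xs → Unique ys
  Unique-resp-↭ p = Permutationₛ.Unique-resp-↭ (setoid Name) (↭⇒↭ₛ p)

  ⊢-distinct : ∀ {𝒢} → ⊢ P ∷∷ 𝒢 → Distinct 𝒢
  ⊢-distinct (exch p t) = Unique-resp-↭ (names-≋ p) (⊢-distinct t)
  ⊢-distinct (cut {Γ = Γ} {Δ} {𝒢} t)
    with _ ∷ _ ∷ u ← Unique-resp-↭ (names-join Γ Δ 𝒢) (⊢-distinct t) = u
  ⊢-distinct (mix u _ _) = u
  ⊢-distinct mix₀ = []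
  ⊢-distinct (tens {Γ = Γ} {Δ} t)
    with _ ∷ u ← Unique-resp-↭ (names-join Γ Δ []) (⊢-distinct t) = u
  ⊢-distinct (one t) = [] ∷ []
  ⊢-distinct (parr t) with _ ∷ u ← ⊢-distinct t = u
  ⊢-distinct (bot u t) = u

  ∈-tail : n ∈ x ∷ xs → n ≢ x → n ∈ xs
  ∈-tail (here e)  n≢x = contradiction e n≢x
  ∈-tail (there i) _   = i

  fn⊆names : ∀ {𝒢} → ⊢ P ∷∷ 𝒢 → n ∈ fn P → n ∈ names 𝒢
  fn⊆names (exch p t) i = ∈-resp-↭ (names-≋ p) (fn⊆names t i)
  fn⊆names (cut {P = P} {Γ = Γ} {Δ} {𝒢} t) i with j , n≢x , n≢y ← fn-ν⁻ P i =
    ∈-tail (∈-tail (∈-resp-↭ (names-join Γ Δ 𝒢) (fn⊆names t j)) n≢x) n≢y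
  fn⊆names (mix {P} {𝒢 = 𝒢} {ℋ} _ t u) i rewrite concatMap-++ (map proj₁) 𝒢 ℋ
    with ∈-++⁻ (fn P) i
  ... | inj₁ j = ∈-++⁺ˡ (fn⊆names t j)
  ... | inj₂ j = ∈-++⁺ʳ (names 𝒢) (fn⊆names u j)
  fn⊆names (tens t) (here e) = here e
  fn⊆names (tens {P = P} {Γ = Γ} {Δ} t) (there i) with j , n∉ ← ∈-∖⁻ {xs = fn P} i =
    ∈-tail (∈-resp-↭ (names-join Γ Δ []) (fn⊆names t j)) (n∉ ∘ here)
  fn⊆names (one t) (here e) = here e
  fn⊆names (one {P = P} t) (there i) with () ← fn⊆names t (proj₁ (∈-∖⁻ {xs = fn P} i))
  fn⊆names (parr t) (here e) = here e
  fn⊆names (parr {P = P} t) (there i) with j , n∉ ← ∈-∖⁻ {xs = fn P} i =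
    ∈-tail (fn⊆names t j) (n∉ ∘ here)
  fn⊆names (bot _ t) (here e) = here e
  fn⊆names (bot {P = P} _ t) (there i) = there (fn⊆names t (proj₁ (∈-∖⁻ {xs = fn P} i)))

  Unique-++⁻ : ∀ xs → Unique (xs ++ ys) → Disjoint xs ys
  Unique-++⁻ (x ∷ xs) (x∉ ∷ u) (here refl , j) = lookup x∉ (∈-++⁺ʳ xs j) refl
  Unique-++⁻ (x ∷ xs) (x∉ ∷ u) (there i , j)   = Unique-++⁻ xs u (i , j)

  -- The conditions are read off the names of hyperenvironments: distinct binders from the premise
  -- of `cut`, disjoint components from `mix`, and no reuse of a closed session from `bot` and from
  -- `one`, whose continuation has no free names.
  ⊢-linear : ∀ {𝒢} → ⊢ P ∷∷ 𝒢 → Linear P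
  ⊢-linear (exch p t) = ⊢-linear t
  ⊢-linear (cut {Γ = Γ} {Δ} {𝒢} t)
    with (x≢y ∷ _) ∷ _ ← Unique-resp-↭ (names-join Γ Δ 𝒢) (⊢-distinct t) = lin-ν x≢y (⊢-linear t)
  ⊢-linear (mix {𝒢 = 𝒢} {ℋ} u t t′) =
    lin-∥ (λ (i , j) → Unique-++⁻ (names 𝒢) (subst Unique (concatMap-++ (map proj₁) 𝒢 ℋ) u)
                         (fn⊆names t i , fn⊆names t′ j))
          (⊢-linear t) (⊢-linear t′)
  ⊢-linear mix₀ = lin-𝟎
  ⊢-linear (tens t) = lin-∙ (λ ()) (⊢-linear t)
  ⊢-linear (one t) = lin-∙ disjoint (⊢-linear t)
    where
    disjoint : Disjoint _ _
    disjoint (_ , j) with () ← fn⊆names t j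
  ⊢-linear (parr t) = lin-∙ (λ ()) (⊢-linear t)
  ⊢-linear (bot {Γ = Γ} (x∉ ∷ _) t) =
    lin-∙ (λ { (here refl , j) → lookup x∉ (fn⊆names t j) refl }) (⊢-linear t)

lemma3p29 : (𝒩 : NameSet) → let open πMLL 𝒩 in
    (P : Proc) → WellTyped P → P ∼ dis P
lemma3p29 𝒩 P (_ , t) = linear-≈⇒∼ (⊢-linear t) (≈-dis P)
  where open Disentanglement 𝒩
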